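{- Let $\mathcal{M}_\Sigma$ be a trace monoid, let $p\in(0,p_\Sigma)$ and let $a_1\in\Sigma$. Then $\mu_{\Sigma\setminus\{a_1\}}(p)>0$, and the real number $$r=p\,\frac{\mu_{\Sigma\setminus\mathscr{L}(a_1)}(p)}{\mu_{\Sigma\setminus\{a_1\}}(p)}$$ satisfies $r=1-\mu_\Sigma(p)/\mu_{\Sigma\setminus\{a_1\}}(p)$. Furthermore, let $T\subseteq\Sigma$ with $a_1\in T$, let $\xi$ be a random trace with law $D^{p}_{\Sigma,T}$, and let $\xi=U_0\cdot\ldots\cdot U_K$ be its decomposition with $U_0,\dots,U_{K-1}\in\mathrm{Pyr}(a_1)$ and $U_K\in\mathcal{M}_{\Sigma\setminus\{a_1\}}$ (so $K=|\xi|_{a_1}$). Then: (1) $K$ is geometric with parameter $r$: $\mathbb{P}(K=k)=(1-r)r^k$ for all integers $k\geqslant0$; (2) for every $k\geqslant0$, conditionally on $\{K=k\}$: (a) $U_0,\dots,U_k$ are independent; (b) each of the traces $U_i\cdot a_1^{ -1}$ for $0\leqslant i\leqslant k-1$ (i.e. the unique trace $w$ with $U_i=w\cdot a_1$) has law $D^{p}_{\Sigma\setminus\{a_1\},\mathscr{L}(a_1)}$; (c) $U_k$ has law $D^{p}_{\Sigma\setminus\{a_1\},T}$.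
   Context: Let $\Sigma$ be a finite alphabet and $\mathcal{R}$ a reflexive and symmetric binary relation on $\Sigma$. The trace monoid $\mathcal{M}_\Sigma$ is the quotient of $\Sigma^*$ by the congruence generated by $ab=ba$ for all $(a,b)\notin\mathcal{R}$; the unit is $\mathbf{e}$. For $\Sigma'\subseteq\Sigma$, $\mathcal{M}_{\Sigma'}$ is the submonoid generated by $\Sigma'$. $|x|$ is the length of $x$, $|x|_a$ the number of occurrences of $a$, and $\max(x)$ the set of letters $a$ with $x=y\cdot a$ for some trace $y$. $\mathscr{L}(a)=\{b\in\Sigma:(a,b)\in\mathcal{R}\}$. $\mathrm{Pyr}(a_1)=\{z\cdot a_1: z\in\mathcal{M}_{\Sigma\setminus\{a_1\}},\ \max(z)\subseteq\mathscr{L}(a_1)\}$; every trace has a unique factorization $u_0\cdots u_k$ with $u_0,\dots,u_{k-1}\in\mathrm{Pyr}(a_1)$, $u_k\in\mathcal{M}_{\Sigma\setminus\{a_1\}}$. For $S\subseteq\Sigma$, a clique of $S$ is a subset of $S$ of pairwise non-$\mathcal{R}$-related letters (empty set included); $\mu_S(X)=\sum_{\gamma\text{ clique of }S}(-1)^{|\gamma|}X^{|\gamma|}$, $\mu_\emptyset=1$. For $S\neq\emptyset$, $p_S$ is the unique root of smallest modulus of $\mu_S$ (real, $0<p_S\leqslant1$); $p_\emptyset=+\infty$. For $p\in(0,p_S)$, $\sum_{x\in\mathcal{M}_S}p^{|x|}=1/\mu_S(p)<\infty$ and $B_{S,p}$ is the probability distribution on $\mathcal{M}_S$ with $B_{S,p}(\{x\})=\mu_S(p)p^{|x|}$.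 For $T\subseteq\Sigma$, $D^{p}_{S,T}$ denotes the conditional distribution $B_{S,p}(\,\cdot\mid\max(\xi)\subseteq T)$ on $\mathcal{M}_S$ (this event has positive probability). -}

module Defs where

open import Level using (0ℓ) renaming (suc to lsuc)
open import Algebra.Bundles using (CommutativeRing; Ring; Semiring)
open import Algebra.Bundles.Raw using (RawRing)
import Algebra.Definitions.RawSemiring as RawSemiringDefs
open import Data.Bool.Base using (true; false)
open import Data.Fin.Base using (Fin)
import Data.Fin.Properties as Fin
open import Data.Fin.Subset using (Subset; _∈_; _⊆_; ∁; ⁅_⁆; ∣_∣; inside; outside)
open import Data.Fin.Subset.Properties using (_∈?_; _⊆?_)
open import Data.List.Base
  using (List; []; _∷_; _++_; map; foldr; filter; concat; applyUpTo; length)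
open import Data.List.Relation.Unary.All using (All)
import Data.List.Relation.Unary.Unique.Setoid as UniqueSetoid
open import Data.Nat.Base as ℕ using (ℕ; zero; suc)
open import Data.Product.Base using (_×_; _,_; ∃; ∃-syntax)
open import Data.Sum.Base using (_⊎_)
import Data.Vec.Base as Vec
open import Relation.Binary.Bundles using (Setoid)
open import Relation.Binary.Core using (Rel)
open import Relation.Binary.Definitions using (Decidable; _Respects_)
open import Relation.Binary.PropositionalEquality using (_≡_; _≢_)
open import Relation.Binary.Structures using (IsStrictTotalOrder)
open import Relation.Nullary.Decidable using (⌊_⌋; ¬?; _×-dec_; _→-dec_)
open import Relation.Nullary.Negation using (¬_)
open import Relation.Unary as U using (Pred; _⊢_; _≐_; ⋃)

-- The real numbers are taken axiomatically, as a Dedekind-complete ordered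
-- field (unique up to isomorphism).  As usual in classical mathematics, _⁻¹
-- and sup are total functions, whose values at 0, respectively at an empty
-- or unbounded set, are unspecified.

record CompleteOrderedField : Set (lsuc 0ℓ) where
  infix  4 _<_ _≤_
  infix  9 _⁻¹
  infixl 7 _/_

  field
    commutativeRing : CommutativeRing 0ℓ 0ℓ

  open CommutativeRing commutativeRing public

  field
    _<_                : Rel Carrier 0ℓ
    isStrictTotalOrder : IsStrictTotalOrder _≈_ _<_
    0<1                : 0# < 1#
    +-monoˡ-<          : ∀ z {x y} → x < y → x + z < y + z
    *-pos              : ∀ {x y} → 0# < x → 0# < y → 0# < x * y
    _⁻¹                : Carrier → Carrier
    *-inverseʳ         : ∀ {x} → x ≉ 0# → x * x ⁻¹ ≈ 1#

  _≤_ : Rel Carrier 0ℓ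
  x ≤ y = x < y ⊎ x ≈ y

  IsUpperBound : Pred Carrier 0ℓ → Carrier → Set
  IsUpperBound A b = ∀ {x} → A x → x ≤ b

  IsSup : Pred Carrier 0ℓ → Carrier → Set
  IsSup A s = IsUpperBound A s × (∀ {b} → IsUpperBound A b → s ≤ b)

  field
    sup       : Pred Carrier 0ℓ → Carrier
    sup-isSup : ∀ {A} → ∃ A → ∃ (IsUpperBound A) → IsSup A (sup A)

  _/_ : Carrier → Carrier → Carrier
  x / y = x * y ⁻¹

  open RawSemiringDefs (Semiring.rawSemiring semiring) public
    using (_^_)

  sumList productList : List Carrier → Carrier
  sumList     = foldr _+_ 0#
  productList = foldr _*_ 1#

  -- The sum of a nonnegative family f over the elements of the setoid X that
  -- satisfy A: the supremum of the sums over finite subsets.  A and f are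
  -- meant to respect the equality of X.
  ∑ : (X : Setoid 0ℓ 0ℓ) → Pred (Setoid.Carrier X) 0ℓ →
      (Setoid.Carrier X → Carrier) → Carrier
  ∑ X A f = sup λ s →
    ∃[ xs ] UniqueSetoid.Unique X xs × All A xs × s ≈ sumList (map f xs)

  infixl 5 _given_
  _given_ : {X : Set} → (Pred X 0ℓ → Carrier) → Pred X 0ℓ → (Pred X 0ℓ → Carrier)
  (ν given E) A = ν (A U.∩ E) / ν E

  ℂ : RawRing 0ℓ 0ℓ
  ℂ = record
    { Carrier = Carrier × Carrier
    ; _≈_ = λ { (a , b) (c , d) → a ≈ c × b ≈ d }
    ; _+_ = λ { (a , b) (c , d) → a + c , b + d }
    ; _*_ = λ { (a , b) (c , d) → a * c - b * d , a * d + b * c }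
    ; -_  = λ { (a , b) → - a , - b }
    ; 0#  = 0# , 0#
    ; 1#  = 1# , 0#
    }

  ∣_∣² : Carrier × Carrier → Carrier
  ∣ (a , b) ∣² = a * a + b * b

-- P is only meaningful on measurable events.
record ProbabilitySpace (ℝ : CompleteOrderedField) : Set (lsuc (lsuc 0ℓ)) where
  open CompleteOrderedField ℝ
  field
    Ω          : Set
    Measurable : Pred (Pred Ω 0ℓ) (lsuc 0ℓ)
    U-meas     : Measurable U.U
    ∁-meas     : ∀ {E} → Measurable E → Measurable (U.∁ E)
    ⋃-meas     : ∀ {E : ℕ → Pred Ω 0ℓ} → (∀ i → Measurable (E i)) → Measurable (⋃ ℕ E)
    resp-meas  : ∀ {E F} → E ≐ F → Measurable E → Measurable F

    P      : Pred Ω 0ℓ → Carrier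
    P-cong : ∀ {E F} → Measurable E → E ≐ F → P E ≈ P F
    P-nonneg : ∀ {E} → Measurable E → 0# ≤ P E
    P-U    : P U.U ≈ 1#
    P-σ    : ∀ {E : ℕ → Pred Ω 0ℓ} → (∀ i → Measurable (E i)) →
             (∀ {i j ω} → E i ω → E j ω → i ≡ j) →
             IsSup (λ s → ∃[ m ] s ≈ sumList (applyUpTo (λ i → P (E i)) m)) (P (⋃ ℕ E))

allSubsets : ∀ n → List (Subset n)
allSubsets zero    = Vec.[] ∷ []
allSubsets (suc n) =
  map (outside Vec.∷_) (allSubsets n) ++ map (inside Vec.∷_) (allSubsets n)

module Traces {n : ℕ} (R : Rel (Fin n) 0ℓ) (R? : Decidable R) where

  -- A trace is represented by a word, traces being compared with _≋_.
  Trace : Set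
  Trace = List (Fin n)

  infix 4 _≋_
  data _≋_ : Rel Trace 0ℓ where
    ≋-refl  : ∀ {x} → x ≋ x
    ≋-sym   : ∀ {x y} → x ≋ y → y ≋ x
    ≋-trans : ∀ {x y z} → x ≋ y → y ≋ z → x ≋ z
    ≋-cong  : ∀ {x x′ y y′} → x ≋ x′ → y ≋ y′ → x ++ y ≋ x′ ++ y′
    ≋-swap  : ∀ {a b} → ¬ R a b → a ∷ b ∷ [] ≋ b ∷ a ∷ []

  traceSetoid : Setoid 0ℓ 0ℓ
  traceSetoid = record
    { Carrier = Trace
    ; _≈_ = _≋_
    ; isEquivalence = record { refl = ≋-refl ; sym = ≋-sym ; trans = ≋-trans }
    }

  -- The submonoid generated by S: the traces that are products of letters of S.
  𝓜 : Subset n → Pred Trace 0ℓ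
  𝓜 S x = ∃[ w ] All (_∈ S) w × x ≋ w

  Max : Trace → Pred (Fin n) 0ℓ
  Max x a = ∃[ y ] x ≋ y ++ a ∷ []

  Max⊆ : Subset n → Pred Trace 0ℓ
  Max⊆ T x = ∀ {a} → Max x a → a ∈ T

  𝓛 : Fin n → Subset n
  𝓛 a = Vec.tabulate λ b → ⌊ R? a b ⌋

  Pyr : Fin n → Pred Trace 0ℓ
  Pyr a x = ∃[ z ] 𝓜 (∁ ⁅ a ⁆) z × Max⊆ (𝓛 a) z × x ≋ z ++ a ∷ []

  -- x = u 0 ⋯ u k; the values of u beyond k are irrelevant.
  IsDecomposition : Fin n → Trace → (k : ℕ) → (ℕ → Trace) → Set
  IsDecomposition a x k u =
    (∀ i → i ℕ.< k → Pyr a (u i)) × 𝓜 (∁ ⁅ a ⁆) (u k) ×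
    x ≋ concat (applyUpTo u (suc k))

  IsClique : Subset n → Pred (Subset n) 0ℓ
  IsClique S γ = γ ⊆ S × (∀ a b → a ∈ γ → b ∈ γ → a ≢ b → ¬ R a b)

  isClique? : ∀ S → U.Decidable (IsClique S)
  isClique? S γ = (γ ⊆? S) ×-dec Fin.all? λ a → Fin.all? λ b →
    (a ∈? γ) →-dec ((b ∈? γ) →-dec (¬? (a Fin.≟ b) →-dec ¬? (R? a b)))

  -- μ_S evaluated at a point of a ring K (below, the real or complex numbers).
  μ[_] : (K : RawRing 0ℓ 0ℓ) → Subset n → RawRing.Carrier K → RawRing.Carrier K
  μ[ K ] S X = foldr _+_ 0# (map term (filter (isClique? S) (allSubsets n)))
    where
    open RawRing K
    open RawSemiringDefs rawSemiring using (_^_)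
    term : Subset n → Carrier
    term γ = (- 1#) ^ ∣ γ ∣ * X ^ ∣ γ ∣

  module Laws (ℝ : CompleteOrderedField) where
    open CompleteOrderedField ℝ

    μ : Subset n → Carrier → Carrier
    μ = μ[ Ring.rawRing ring ]

    -- ρ = p_S: the real ρ is a root of μ_S, and every other complex root of μ_S
    -- has strictly larger modulus; moduli are compared through their squares.
    IsSmallestRoot : Subset n → Carrier → Set
    IsSmallestRoot S ρ =
      μ[ ℂ ] S (ρ , 0#) ≈ᶜ (0# , 0#) ×
      (∀ z → μ[ ℂ ] S z ≈ᶜ (0# , 0#) → ¬ z ≈ᶜ (ρ , 0#) → ∣ (ρ , 0#) ∣² < ∣ z ∣²)
      where open RawRing ℂ using () renaming (_≈_ to _≈ᶜ_)

    B : Subset n → Carrier → Pred Trace 0ℓ → Carrier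
    B S p A = ∑ traceSetoid (A U.∩ 𝓜 S) (λ x → μ S p * p ^ length x)

    D : Subset n → Subset n → Carrier → Pred Trace 0ℓ → Carrier
    D S T p = B S p given Max⊆ T

    -- Sets of traces are predicates on words that respect _≋_.
    module _ (𝓟 : ProbabilitySpace ℝ) where
      open ProbabilitySpace 𝓟

      IsRandomTrace : (Ω → Trace) → Set (lsuc 0ℓ)
      IsRandomTrace ξ = ∀ {A} → A Respects _≋_ → Measurable (ξ ⊢ A)

      -- Q is a probability on Ω: P itself, or P conditioned on an event.
      HasLaw : (Pred Ω 0ℓ → Carrier) → (Ω → Trace) → (Pred Trace 0ℓ → Carrier) →
               Set (lsuc 0ℓ)
      HasLaw Q ξ ν = ∀ {A} → A Respects _≋_ → Q (ξ ⊢ A) ≈ ν A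

      -- Taking some A i to be everything gives the same product formula for
      -- subfamilies of V 0, …, V k.
      Independent : (Pred Ω 0ℓ → Carrier) → ℕ → (ℕ → Ω → Trace) → Set (lsuc 0ℓ)
      Independent Q k V = (A : ℕ → Pred Trace 0ℓ) → (∀ i → A i Respects _≋_) →
        Q (λ ω → ∀ i → i ℕ.≤ k → A i (V i ω)) ≈
        productList (applyUpTo (λ i → Q (V i ⊢ A i)) (suc k))

{-# OPTIONS --safe #-}

-- Give each trace x the weight p ^ |x|.  If a is a letter of S ∩ T, then the
-- traces over S with maximal letters in T are the products u · y of a pyramid u
-- of apex a with a trace y of the same kind, or else contain no a; since the
-- factorization is unique, the weight Z of this set satisfies Z = Z₀ + r Z, where
-- Z₀ is the weight of those without a, and r is the weight of the pyramids.
-- By induction on S and with the recursion μ_S = μ_{S∖a} − X μ_{S∖𝓛(a)}, this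
-- gives Z = μ_{S∖T}(p) / μ_S(p).  The weight of the traces whose k pyramids and
-- last factor lie in prescribed sets is a product, which yields the laws.
--
-- Positivity of all μ_S(p) follows from that of μ_Σ on [0, p]: at the first point
-- where some μ_S vanishes all μ_S are nonnegative, hence by the recursion
-- decreasing in S, so that μ_Σ would vanish there.
--
-- Uniqueness of factorizations rests on the fact that two words represent the
-- same trace iff they have equal projections to all pairs of related letters.
module Submission where

open import Defs
open import Level using (0ℓ)
open import Algebra.Bundles using (CommutativeRing; RawRing)
import Algebra.Definitions.RawSemiring as RawSemiringDefs
import Algebra.Properties.AbelianGroup as AbelianGroupProperties
import Algebra.Properties.Ring as RingProperties
import Algebra.Properties.Semiring.Exp as Exp
import Algebra.Properties.Semiring.Mult.TCOptimised as Mult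
import Algebra.Solver.Ring as RingSolver
open import Algebra.Solver.Ring.AlmostCommutativeRing
  using (fromCommutativeRing; _-Raw-AlmostCommutative⟶_; Induced-equivalence)
open import Data.Bool.Base using (true; false; if_then_else_)
open import Data.Empty using (⊥; ⊥-elim)
open import Data.Fin.Base using (Fin; zero; suc)
import Data.Fin.Properties as Fin
open import Data.Fin.Subset as Subset
  using (Subset; inside; outside; _∈_; _∉_; _⊆_; _⊂_; _∩_; ⊤; ∁; ⁅_⁆; ∣_∣)
open import Data.Fin.Subset.Induction using (⊂-wellFounded)
import Data.Fin.Subset.Properties as Subset
open import Data.Integer.Base as ℤ using (ℤ; -[1+_]; _⊖_) renaming (+_ to pos)
import Data.Integer.Properties as ℤ
open import Data.List.Base
  using (List; []; _∷_; _++_; [_]; _∷ʳ_; length; map; filter; foldr; concat;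
         applyUpTo; cartesianProductWith; deduplicate)
import Data.List.Membership.Propositional as Membership
open import Data.List.Membership.Propositional.Properties using (∈-filter⁺; ∈-filter⁻; ∈-++⁺ʳ)
import Data.List.Membership.Setoid.Properties as SetoidMembership
import Data.List.Properties as List
open import Data.List.Relation.Binary.Permutation.Propositional as ↭ using (_↭_)
import Data.List.Relation.Binary.Permutation.Propositional.Properties as ↭
open import Data.List.Relation.Unary.All as All using (All; []; _∷_; all?)
import Data.List.Relation.Unary.All.Properties as All
open import Data.List.Relation.Unary.AllPairs using ([]; _∷_)
import Data.List.Relation.Unary.AllPairs.Properties as AllPairs
open import Data.List.Relation.Unary.Any as Any using (Any; here; there; any?; _─_)
import Data.List.Relation.Unary.Unique.DecSetoid.Properties as UniqueDecSetoid
import Data.List.Relation.Unary.Unique.Setoid as UniqueSetoid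
import Data.List.Relation.Unary.Unique.Setoid.Properties as UniqueSetoid
open import Data.List.Reverse using (Reverse; []; _∶_∶ʳ_; reverseView)
open import Data.Maybe.Base using (just; nothing)
open import Data.Nat.Base as ℕ using (ℕ; zero; suc; z≤n; s≤s)
import Data.Nat.Properties as ℕ
open import Data.Product.Base using (_×_; _,_; ∃-syntax; proj₁; proj₂)
open import Data.Sum.Base using (_⊎_; inj₁; inj₂)
open import Data.Vec.Base as Vec using (lookup; _[_]≔_)
import Data.Vec.Properties as Vec
open import Function.Base using (_∘_; id)
import Induction.WellFounded as WellFounded
open import Relation.Binary.Bundles using (DecSetoid; DecTotalOrder; StrictTotalOrder)
import Relation.Binary.Construct.StrictToNonStrict as StrictToNonStrict
open import Relation.Binary.Core using (Rel)
open import Relation.Binary.Definitions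
  using (Decidable; Reflexive; Symmetric; WeaklyDecidable; _Respects_; tri<; tri≈; tri>)
open import Relation.Binary.PropositionalEquality as ≡ using (_≡_; _≢_)
import Relation.Binary.Reasoning.StrictPartialOrder as StrictReasoning
open import Relation.Nullary using (¬_; Dec; yes; no; does)
open import Relation.Nullary.Decidable
  using (_⊎-dec_; _×-dec_; _→-dec_; ¬?; map′; dec-true; dec-false; isYes)
open import Relation.Unary as U using (Pred; _≐_; _⊢_)
open import Relation.Unary.Algebra using (∩-comm)
open import Relation.Unary.Properties using (≐-trans)

-- Three points shape the proof. A weight is a supremum of finite sums, so nothing can be computed
-- with it before these sums are bounded; finiteness is therefore an outcome of the same induction
-- that yields the value, and no convergence is presupposed. The set T has to vary in this induction
-- even if only T = Σ is of interest: a pyramid over S without its apex is a trace over the smaller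
-- alphabet with maximal letters in 𝓛(a), so that r is p times the value for T = 𝓛(a). Finally, the
-- hypothesis speaks about the roots of μ_Σ alone and says nothing about those of the other μ_S,
-- which is why positivity is proved for the whole family at once.
--
-- The passage to probabilities uses that K and the factors are determined by ξ: each event about
-- them is an event about ξ, whose law is given. All conditional laws are then ratios of weights in
-- which the normalising constants cancel; the value of r matters only for the law of K.

-- Ring identities with integer coefficients.

module IntegerCoefficients {c ℓ} (R : CommutativeRing c ℓ) where
  open CommutativeRing R
  open Mult semiring using (1+×; ×-homo-+; ×1-homo-*) renaming (_×_ to _·_)
  open RingProperties ring using (-‿distribˡ-*; -‿distribʳ-*)
  open AbelianGroupProperties +-abelianGroup
    using (⁻¹-∙-comm; ⁻¹-involutive; ε⁻¹≈ε; xyx⁻¹≈y)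
  open import Relation.Binary.Reasoning.Setoid setoid

  -- The optimised multiple `1 · 1#` is `1#` by definition, so that `con (pos 0)` and `con (pos 1)`
  -- in solver calls denote `0#` and `1#` on the nose.
  ⟦_⟧ : ℤ → Carrier
  ⟦ pos n ⟧    = n · 1#
  ⟦ -[1+ n ] ⟧ = - (suc n · 1#)

  ⟦⊖⟧ : ∀ m n → ⟦ m ⊖ n ⟧ ≈ m · 1# - n · 1#
  ⟦⊖⟧ m zero = begin
    m · 1#           ≈⟨ +-identityʳ _ ⟨
    m · 1# + 0#      ≈⟨ +-congˡ ε⁻¹≈ε ⟨
    m · 1# - 0#      ∎
  ⟦⊖⟧ zero (suc n) = sym (+-identityˡ _)
  ⟦⊖⟧ (suc m) (suc n) = begin
    ⟦ suc m ⊖ suc n ⟧                 ≡⟨ ≡.cong ⟦_⟧ (ℤ.[1+m]⊖[1+n]≡m⊖n m n) ⟩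
    ⟦ m ⊖ n ⟧                         ≈⟨ ⟦⊖⟧ m n ⟩
    m · 1# - n · 1#                   ≈⟨ +-congʳ (xyx⁻¹≈y 1# _) ⟨
    1# + m · 1# - 1# - n · 1#         ≈⟨ +-assoc _ _ _ ⟩
    1# + m · 1# + (- 1# - n · 1#)     ≈⟨ +-congˡ (⁻¹-∙-comm _ _) ⟩
    (1# + m · 1#) - (1# + n · 1#)     ≈⟨ +-cong (1+× m 1#) (-‿cong (1+× n 1#)) ⟨
    suc m · 1# - suc n · 1#           ∎

  ⟦-⟧ : ∀ i → ⟦ ℤ.- i ⟧ ≈ - ⟦ i ⟧
  ⟦-⟧ (pos zero)    = sym ε⁻¹≈ε
  ⟦-⟧ (pos (suc n)) = refl
  ⟦-⟧ -[1+ n ]      = sym (⁻¹-involutive _)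

  ⟦+⟧ : ∀ i j → ⟦ i ℤ.+ j ⟧ ≈ ⟦ i ⟧ + ⟦ j ⟧
  ⟦+⟧ (pos m)    (pos n)    = ×-homo-+ 1# m n
  ⟦+⟧ (pos m)    -[1+ n ]   = ⟦⊖⟧ m (suc n)
  ⟦+⟧ -[1+ m ]   (pos n)    = trans (⟦⊖⟧ n (suc m)) (+-comm _ _)
  ⟦+⟧ -[1+ m ]   -[1+ n ]   = begin
    - (suc (suc (m ℕ.+ n)) · 1#)      ≡⟨ ≡.cong (λ k → - (k · 1#)) (ℕ.+-suc (suc m) n) ⟨
    - ((suc m ℕ.+ suc n) · 1#)        ≈⟨ -‿cong (×-homo-+ 1# (suc m) (suc n)) ⟩
    - (suc m · 1# + suc n · 1#)       ≈⟨ ⁻¹-∙-comm _ _ ⟨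
    - (suc m · 1#) - suc n · 1#       ∎

  ⟦pos*⟧ : ∀ m j → ⟦ pos m ℤ.* j ⟧ ≈ ⟦ pos m ⟧ * ⟦ j ⟧
  ⟦pos*⟧ m (pos n) = trans (reflexive (≡.cong ⟦_⟧ (≡.sym (ℤ.pos-* m n)))) (×1-homo-* m n)
  ⟦pos*⟧ m -[1+ n ] = begin
    ⟦ pos m ℤ.* -[1+ n ] ⟧            ≡⟨ ≡.cong ⟦_⟧ (ℤ.neg-distribʳ-* (pos m) (pos (suc n))) ⟨
    ⟦ ℤ.- (pos m ℤ.* pos (suc n)) ⟧   ≈⟨ ⟦-⟧ (pos m ℤ.* pos (suc n)) ⟩
    - ⟦ pos m ℤ.* pos (suc n) ⟧       ≈⟨ -‿cong (⟦pos*⟧ m (pos (suc n))) ⟩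
    - (m · 1# * suc n · 1#)           ≈⟨ -‿distribʳ-* _ _ ⟩
    m · 1# * - (suc n · 1#)           ∎

  ⟦*⟧ : ∀ i j → ⟦ i ℤ.* j ⟧ ≈ ⟦ i ⟧ * ⟦ j ⟧
  ⟦*⟧ (pos m) j = ⟦pos*⟧ m j
  ⟦*⟧ -[1+ m ] j = begin
    ⟦ -[1+ m ] ℤ.* j ⟧                ≡⟨ ≡.cong ⟦_⟧ (ℤ.neg-distribˡ-* (pos (suc m)) j) ⟨
    ⟦ ℤ.- (pos (suc m) ℤ.* j) ⟧       ≈⟨ ⟦-⟧ (pos (suc m) ℤ.* j) ⟩
    - ⟦ pos (suc m) ℤ.* j ⟧           ≈⟨ -‿cong (⟦pos*⟧ (suc m) j) ⟩
    - (suc m · 1# * ⟦ j ⟧)            ≈⟨ -‿distribˡ-* _ _ ⟩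
    - (suc m · 1#) * ⟦ j ⟧            ∎

  homomorphism : ℤ.+-*-rawRing -Raw-AlmostCommutative⟶ fromCommutativeRing R
  homomorphism = record
    { ⟦_⟧ = ⟦_⟧ ; +-homo = ⟦+⟧ ; *-homo = ⟦*⟧ ; -‿homo = ⟦-⟧
    ; 0-homo = refl ; 1-homo = refl }

  _≟_ : WeaklyDecidable (Induced-equivalence homomorphism)
  i ≟ j with i ℤ.≟ j
  ... | yes i≡j = just (reflexive (≡.cong ⟦_⟧ i≡j))
  ... | no  _   = nothing

  open RingSolver ℤ.+-*-rawRing (fromCommutativeRing R) homomorphism _≟_ public
    using (solve; _:+_; _:*_; _:-_; :-_; _:=_; con)

-- Ordered fields and suprema.

module Reals (ℝ : CompleteOrderedField) where
  open CompleteOrderedField ℝ hiding (zero)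

  strictTotalOrder : StrictTotalOrder 0ℓ 0ℓ 0ℓ
  strictTotalOrder = record { isStrictTotalOrder = isStrictTotalOrder }

  open StrictTotalOrder strictTotalOrder public
    using (compare; _<?_; <-respʳ-≈; <-respˡ-≈)
    renaming (trans to <-trans; irrefl to <-irrefl; asym to <-asym)

  decTotalOrder : DecTotalOrder 0ℓ 0ℓ 0ℓ
  decTotalOrder = record
    { isDecTotalOrder = StrictToNonStrict.isDecTotalOrder _≈_ _<_ isStrictTotalOrder }

  open DecTotalOrder decTotalOrder public
    using (_≤?_; antisym)
    renaming (trans to ≤-trans; reflexive to ≤-reflexive; refl to ≤-refl)

  open StrictReasoning (StrictTotalOrder.strictPartialOrder strictTotalOrder) public
  open IntegerCoefficients commutativeRing public
    using (solve; _:+_; _:*_; _:-_; :-_; _:=_; con)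

  ≰⇒> : ∀ {x y} → ¬ x ≤ y → y < x
  ≰⇒> {x} {y} x≰y with compare x y
  ... | tri< x<y _ _ = ⊥-elim (x≰y (inj₁ x<y))
  ... | tri≈ _ x≈y _ = ⊥-elim (x≰y (inj₂ x≈y))
  ... | tri> _ _ y<x = y<x

  ≮⇒≥ : ∀ {x y} → ¬ x < y → y ≤ x
  ≮⇒≥ {x} {y} x≮y with compare x y
  ... | tri< x<y _ _ = ⊥-elim (x≮y x<y)
  ... | tri≈ _ x≈y _ = inj₂ (sym x≈y)
  ... | tri> _ _ y<x = inj₁ y<x

  <⇒≱ : ∀ {x y} → x < y → ¬ y ≤ x
  <⇒≱ x<y (inj₁ y<x) = <-asym x<y y<x
  <⇒≱ x<y (inj₂ y≈x) = <-irrefl (sym y≈x) x<y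

  >⇒≉ : ∀ {x y} → y < x → x ≉ y
  >⇒≉ y<x x≈y = <-irrefl (sym x≈y) y<x

  <-≤-trans : ∀ {x y z} → x < y → y ≤ z → x < z
  <-≤-trans {x} {y} {z} x<y y≤z = begin-strict
    x  <⟨ x<y ⟩
    y  ≤⟨ y≤z ⟩
    z  ∎

  <⇒≤ : ∀ {x y} → x < y → x ≤ y
  <⇒≤ = inj₁

  0≤1 : 0# ≤ 1#
  0≤1 = inj₁ 0<1

  <⇒0<- : ∀ {x y} → x < y → 0# < y - x
  <⇒0<- {x} x<y = <-respˡ-≈ (-‿inverseʳ x) (+-monoˡ-< (- x) x<y)

  0<-⇒< : ∀ {x y} → 0# < y - x → x < y
  0<-⇒< {x} {y} 0<y-x = begin-strict
    x           ≈⟨ +-identityˡ x ⟨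
    0# + x      <⟨ +-monoˡ-< x 0<y-x ⟩
    y - x + x   ≈⟨ solve 2 (λ x y → y :- x :+ x := y) refl x y ⟩
    y           ∎

  ≤⇒0≤- : ∀ {x y} → x ≤ y → 0# ≤ y - x
  ≤⇒0≤- (inj₁ x<y) = inj₁ (<⇒0<- x<y)
  ≤⇒0≤- {x} {y} (inj₂ x≈y) = inj₂ (sym (trans (+-congˡ (-‿cong x≈y)) (-‿inverseʳ y)))

  0≤-⇒≤ : ∀ {x y} → 0# ≤ y - x → x ≤ y
  0≤-⇒≤ (inj₁ 0<y-x) = inj₁ (0<-⇒< 0<y-x)
  0≤-⇒≤ {x} {y} (inj₂ 0≈y-x) = inj₂ (begin-equality
    x           ≈⟨ +-identityˡ x ⟨
    0# + x      ≈⟨ +-congʳ 0≈y-x ⟩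
    y - x + x   ≈⟨ solve 2 (λ x y → y :- x :+ x := y) refl x y ⟩
    y           ∎)

  ≤-by : ∀ {x y d} → 0# ≤ d → d ≈ y - x → x ≤ y
  ≤-by 0≤d d≈ = 0≤-⇒≤ (≤-trans 0≤d (≤-reflexive d≈))

  <-by : ∀ {x y d} → 0# < d → d ≈ y - x → x < y
  <-by 0<d d≈ = 0<-⇒< (<-respʳ-≈ d≈ 0<d)

  +-pos-nonneg : ∀ {x y} → 0# < x → 0# ≤ y → 0# < x + y
  +-pos-nonneg {x} {y} 0<x 0≤y = begin-strict
    0#      ≤⟨ 0≤y ⟩
    y       ≈⟨ +-identityˡ y ⟨
    0# + y  <⟨ +-monoˡ-< y 0<x ⟩
    x + y   ∎

  +-nonneg : ∀ {x y} → 0# ≤ x → 0# ≤ y → 0# ≤ x + y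
  +-nonneg (inj₁ 0<x) 0≤y = inj₁ (+-pos-nonneg 0<x 0≤y)
  +-nonneg {x} {y} (inj₂ 0≈x) 0≤y = begin
    0#      ≤⟨ 0≤y ⟩
    y       ≈⟨ +-identityˡ y ⟨
    0# + y  ≈⟨ +-congʳ 0≈x ⟩
    x + y   ∎

  *-nonneg : ∀ {x y} → 0# ≤ x → 0# ≤ y → 0# ≤ x * y
  *-nonneg (inj₁ 0<x) (inj₁ 0<y) = inj₁ (*-pos 0<x 0<y)
  *-nonneg {x} {y} (inj₂ 0≈x) _ = inj₂ (trans (sym (zeroˡ y)) (*-congʳ 0≈x))
  *-nonneg {x} {y} (inj₁ _) (inj₂ 0≈y) = inj₂ (trans (sym (zeroʳ x)) (*-congˡ 0≈y))

  +-mono-≤ : ∀ {x y u v} → x ≤ y → u ≤ v → x + u ≤ y + v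
  +-mono-≤ {x} {y} {u} {v} x≤y u≤v = ≤-by (+-nonneg (≤⇒0≤- x≤y) (≤⇒0≤- u≤v))
    (solve 4 (λ x y u v → (y :- x) :+ (v :- u) := (y :+ v) :- (x :+ u)) refl x y u v)

  *-monoˡ-≤ : ∀ {c x y} → 0# ≤ c → x ≤ y → c * x ≤ c * y
  *-monoˡ-≤ {c} {x} {y} 0≤c x≤y = ≤-by (*-nonneg 0≤c (≤⇒0≤- x≤y))
    (solve 3 (λ c x y → c :* (y :- x) := c :* y :- c :* x) refl c x y)

  *-monoʳ-≤ : ∀ {c x y} → 0# ≤ c → x ≤ y → x * c ≤ y * c
  *-monoʳ-≤ {c} {x} {y} 0≤c x≤y = ≤-by (*-nonneg 0≤c (≤⇒0≤- x≤y))
    (solve 3 (λ c x y → c :* (y :- x) := y :* c :- x :* c) refl c x y)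

  x≤x+y : ∀ {x y} → 0# ≤ y → x ≤ x + y
  x≤x+y {x} {y} 0≤y = ≤-by 0≤y (solve 2 (λ x y → y := x :+ y :- x) refl x y)

  +-cancelˡ-≤ : ∀ {x y z} → x + y ≤ z → y ≤ z - x
  +-cancelˡ-≤ {x} {y} {z} x+y≤z = ≤-by (≤⇒0≤- x+y≤z)
    (solve 3 (λ x y z → z :- (x :+ y) := z :- x :- y) refl x y z)

  ^-pos : ∀ {x} → 0# < x → ∀ n → 0# < x ^ n
  ^-pos 0<x zero    = 0<1
  ^-pos 0<x (suc n) = *-pos 0<x (^-pos 0<x n)

  *-inverseˡ : ∀ {x} → x ≉ 0# → x ⁻¹ * x ≈ 1#
  *-inverseˡ {x} x≉0 = trans (*-comm (x ⁻¹) x) (*-inverseʳ x≉0)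

  /-unique : ∀ {x y z} → y ≉ 0# → x ≈ z * y → x / y ≈ z
  /-unique {x} {y} {z} y≉0 x≈zy = begin-equality
    x * y ⁻¹        ≈⟨ *-congʳ x≈zy ⟩
    z * y * y ⁻¹    ≈⟨ *-assoc z y (y ⁻¹) ⟩
    z * (y * y ⁻¹)  ≈⟨ *-congˡ (*-inverseʳ y≉0) ⟩
    z * 1#          ≈⟨ *-identityʳ z ⟩
    z               ∎

  /-* : ∀ {x y} → y ≉ 0# → x / y * y ≈ x
  /-* {x} {y} y≉0 = begin-equality
    x * y ⁻¹ * y    ≈⟨ *-assoc x (y ⁻¹) y ⟩
    x * (y ⁻¹ * y)  ≈⟨ *-congˡ (*-inverseˡ y≉0) ⟩
    x * 1#          ≈⟨ *-identityʳ x ⟩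
    x               ∎

  *-cancelʳ : ∀ {x y z} → z ≉ 0# → x * z ≈ y * z → x ≈ y
  *-cancelʳ {x} {y} {z} z≉0 xz≈yz = trans (sym (/-unique z≉0 refl)) (/-unique z≉0 xz≈yz)

  ⁻¹-pos : ∀ {x} → 0# < x → 0# < x ⁻¹
  ⁻¹-pos {x} 0<x with compare 0# (x ⁻¹)
  ... | tri< 0<x⁻¹ _ _ = 0<x⁻¹
  ... | tri≈ _ 0≈x⁻¹ _ = ⊥-elim (<-irrefl (begin-equality
      0#        ≈⟨ zeroʳ x ⟨
      x * 0#    ≈⟨ *-congˡ 0≈x⁻¹ ⟩
      x * x ⁻¹  ≈⟨ *-inverseʳ (>⇒≉ 0<x) ⟩
      1#        ∎) 0<1)
  ... | tri> _ _ x⁻¹<0 = ⊥-elim (<-asym 0<1 (<-by (*-pos 0<x (<⇒0<- x⁻¹<0)) (begin-equality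
      x * (0# - x ⁻¹)   ≈⟨ solve 2 (λ x i → x :* (con (pos 0) :- i) := con (pos 0) :- x :* i) refl x (x ⁻¹) ⟩
      0# - x * x ⁻¹     ≈⟨ +-congˡ (-‿cong (*-inverseʳ (>⇒≉ 0<x))) ⟩
      0# - 1#           ∎)))

  /-pos : ∀ {x y} → 0# < x → 0# < y → 0# < x / y
  /-pos 0<x 0<y = *-pos 0<x (⁻¹-pos 0<y)

  *-≉0 : ∀ {x y} → x ≉ 0# → y ≉ 0# → x * y ≉ 0#
  *-≉0 {x} {y} x≉0 y≉0 xy≈0 = x≉0 (*-cancelʳ y≉0 (trans xy≈0 (sym (zeroˡ y))))

  sup-unique : ∀ {A s t} → IsSup A s → IsSup A t → s ≈ t
  sup-unique (ub-s , least-s) (ub-t , least-t) = antisym (least-s ub-t) (least-t ub-s)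

  IsSup-resp-≈ : ∀ {A s t} → s ≈ t → IsSup A s → IsSup A t
  IsSup-resp-≈ s≈t (ub , least) =
    (λ a → ≤-trans (ub a) (≤-reflexive s≈t)) , λ b → ≤-trans (≤-reflexive (sym s≈t)) (least b)

  -- For c > 0 the quotient b / c bounds `A`. For c = 0 there is no such quotient, and the claim
  -- reduces to 0 ≤ b.
  *-sup-≤ : ∀ {A s b c} → IsSup A s → 0# ≤ c → 0# ≤ b → (∀ {x} → A x → c * x ≤ b) → c * s ≤ b
  *-sup-≤ {A} {s} {b} {c} _ (inj₂ 0≈c) 0≤b _ = begin
    c * s   ≈⟨ *-congʳ 0≈c ⟨
    0# * s  ≈⟨ zeroˡ s ⟩
    0#      ≤⟨ 0≤b ⟩
    b       ∎
  *-sup-≤ {A} {s} {b} {c} (_ , least) (inj₁ 0<c) _ cA≤b = begin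
    c * s          ≤⟨ *-monoˡ-≤ (inj₁ 0<c) (least s≤) ⟩
    c * (b * c ⁻¹) ≈⟨ *-comm c _ ⟩
    b / c * c      ≈⟨ /-* (>⇒≉ 0<c) ⟩
    b              ∎
    where
    s≤ : IsUpperBound A (b / c)
    s≤ {x} a = begin
      x            ≈⟨ /-unique (>⇒≉ 0<c) (*-comm c x) ⟨
      c * x / c    ≤⟨ *-monoʳ-≤ (inj₁ (⁻¹-pos 0<c)) (cA≤b a) ⟩
      b / c        ∎

-- Traces: projections, maximal letters, cancellation.

∷≡∷ʳ : ∀ {A : Set} {c b : A} {x} l → c ∷ x ≡ l ∷ʳ b → (x ≡ [] × c ≡ b) ⊎ ∃[ m ] x ≡ m ∷ʳ b
∷≡∷ʳ []      ≡.refl = inj₁ (≡.refl , ≡.refl)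
∷≡∷ʳ (_ ∷ l) ≡.refl = inj₂ (l , ≡.refl)

∈⇒≢[] : ∀ {A : Set} {b : A} {x} → b Membership.∈ x → x ≢ []
∈⇒≢[] (here _)  ()
∈⇒≢[] (there _) ()

filter-swap : ∀ {A : Set} {P : Pred A 0ℓ} (P? : U.Decidable P) c d → (P c → ¬ P d) →
              filter P? (c ∷ d ∷ []) ≡ filter P? (d ∷ c ∷ [])
filter-swap P? c d ¬both with P? c in eqc | P? d in eqd
... | no _   | no _   rewrite eqc | eqd = ≡.refl
... | no _   | yes _  rewrite eqc | eqd = ≡.refl
... | yes _  | no _   rewrite eqc | eqd = ≡.refl
... | yes pc | yes pd = ⊥-elim (¬both pc pd)

module TraceTheory {n : ℕ} (R : Rel (Fin n) 0ℓ) (R? : Decidable R)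
                   (R-refl : Reflexive R) (R-sym : Symmetric R) where
  open Traces R R?
  open Membership using () renaming (_∈_ to _∈ₗ_)
  open ≡.≡-Reasoning

  among? : (a b : Fin n) → U.Decidable (λ c → c ≡ a ⊎ c ≡ b)
  among? a b c = (c Fin.≟ a) ⊎-dec (c Fin.≟ b)

  π : Fin n → Fin n → Trace → Trace
  π a b = filter (among? a b)

  infix 4 _∼_
  -- The classical embedding of the trace monoid into a product of free monoids. The pairs (a, a)
  -- take part because `R` is reflexive; they record the number of occurrences of a. Cancellation
  -- and decidability are inherited from words.
  _∼_ : Rel Trace 0ℓ
  x ∼ y = ∀ a b → R a b → π a b x ≡ π a b y

  ≋⇒∼ : ∀ {x y} → x ≋ y → x ∼ y
  ≋⇒∼ ≋-refl a b r = ≡.refl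
  ≋⇒∼ (≋-sym x≋y) a b r = ≡.sym (≋⇒∼ x≋y a b r)
  ≋⇒∼ (≋-trans x≋y y≋z) a b r = ≡.trans (≋⇒∼ x≋y a b r) (≋⇒∼ y≋z a b r)
  ≋⇒∼ (≋-cong {x} {x′} {y} {y′} x≋x′ y≋y′) a b r = begin
    π a b (x ++ y)         ≡⟨ List.filter-++ (among? a b) x y ⟩
    π a b x ++ π a b y     ≡⟨ ≡.cong₂ _++_ (≋⇒∼ x≋x′ a b r) (≋⇒∼ y≋y′ a b r) ⟩
    π a b x′ ++ π a b y′   ≡⟨ List.filter-++ (among? a b) x′ y′ ⟨
    π a b (x′ ++ y′)       ∎
  ≋⇒∼ (≋-swap {c} {d} ¬Rcd) a b r = filter-swap (among? a b) c d λ where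
    (inj₁ ≡.refl) (inj₁ ≡.refl) → ¬Rcd R-refl
    (inj₁ ≡.refl) (inj₂ ≡.refl) → ¬Rcd r
    (inj₂ ≡.refl) (inj₁ ≡.refl) → ¬Rcd (R-sym r)
    (inj₂ ≡.refl) (inj₂ ≡.refl) → ¬Rcd R-refl

  ∼-cancelˡ : ∀ x y z → x ++ y ∼ x ++ z → y ∼ z
  ∼-cancelˡ x y z xy∼xz a b r = List.++-cancelˡ (π a b x) _ _ (begin
    π a b x ++ π a b y  ≡⟨ List.filter-++ (among? a b) x y ⟨
    π a b (x ++ y)      ≡⟨ xy∼xz a b r ⟩
    π a b (x ++ z)      ≡⟨ List.filter-++ (among? a b) x z ⟩
    π a b x ++ π a b z  ∎)

  ∼-cancelʳ : ∀ x y z → y ++ x ∼ z ++ x → y ∼ z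
  ∼-cancelʳ x y z yx∼zx a b r = List.++-cancelʳ (π a b x) _ _ (begin
    π a b y ++ π a b x  ≡⟨ List.filter-++ (among? a b) y x ⟨
    π a b (y ++ x)      ≡⟨ yx∼zx a b r ⟩
    π a b (z ++ x)      ≡⟨ List.filter-++ (among? a b) z x ⟩
    π a b z ++ π a b x  ∎)

  -- A form of `Max` that follows the word: some occurrence of b, necessarily the last one, is
  -- followed by letters unrelated to b only. It can be taken apart along `++`, whereas `Max`
  -- quantifies over all words of the same trace.
  Maximal : Fin n → Trace → Set
  Maximal b []      = ⊥
  Maximal b (c ∷ x) = Maximal b x ⊎ (c ≡ b × All (λ d → ¬ R b d) x)

  Maximal-++⁻ : ∀ {b} x {y} → Maximal b (x ++ y) →
                Maximal b y ⊎ (Maximal b x × All (λ d → ¬ R b d) y)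
  Maximal-++⁻ []      m        = inj₁ m
  Maximal-++⁻ (c ∷ x) (inj₁ m) with Maximal-++⁻ x m
  ... | inj₁ my           = inj₁ my
  ... | inj₂ (mx , ¬Ry)   = inj₂ (inj₁ mx , ¬Ry)
  Maximal-++⁻ (c ∷ x) (inj₂ (c≡b , ¬R)) with All.++⁻ x ¬R
  ... | ¬Rx , ¬Ry = inj₂ (inj₂ (c≡b , ¬Rx) , ¬Ry)

  ∷-commute : ∀ {b x} → All (λ d → ¬ R b d) x → b ∷ x ≋ x ∷ʳ b
  ∷-commute []          = ≋-refl
  ∷-commute {b} (_∷_ {c} ¬Rbc ¬R) =
    ≋-trans (≋-cong (≋-swap ¬Rbc) ≋-refl) (≋-cong (≋-refl {[ c ]}) (∷-commute ¬R))

  Maximal⇒≋∷ʳ : ∀ {b x} → Maximal b x → ∃[ y ] x ≋ y ∷ʳ b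
  Maximal⇒≋∷ʳ {x = c ∷ x} (inj₁ m) with Maximal⇒≋∷ʳ m
  ... | y , x≋yb = c ∷ y , ≋-cong (≋-refl {[ c ]}) x≋yb
  Maximal⇒≋∷ʳ {x = c ∷ x} (inj₂ (≡.refl , ¬R)) = x , ∷-commute ¬R

  π-ends⇒Maximal : ∀ {b} x → (∀ d → R b d → ∃[ l ] π b d x ≡ l ∷ʳ b) → Maximal b x
  π-ends⇒Maximal {b} [] ends with ends b R-refl
  ... | []    , ()
  ... | _ ∷ _ , ()
  π-ends⇒Maximal {b} (c ∷ x) ends with any? (b Fin.≟_) x
  ... | yes b∈x = inj₁ (π-ends⇒Maximal x ends′)
    where
    ends′ : ∀ d → R b d → ∃[ l ] π b d x ≡ l ∷ʳ b
    ends′ d r with among? b d c | ends d r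
    ... | no ¬p | l , eq = l , ≡.trans (≡.sym (List.filter-reject (among? b d) ¬p)) eq
    ... | yes p | l , eq with ∷≡∷ʳ l (≡.trans (≡.sym (List.filter-accept (among? b d) p)) eq)
    ...   | inj₁ (πx≡[] , _) = ⊥-elim (∈⇒≢[] (∈-filter⁺ (among? b d) b∈x (inj₁ ≡.refl)) πx≡[])
    ...   | inj₂ last        = last
  ... | no b∉x = inj₂ (c≡b , All.tabulate ¬R)
    where
    c≡b : c ≡ b
    c≡b with ends b R-refl
    ... | l , eq with proj₁ (∈-filter⁻ (among? b b) {xs = c ∷ x}
                               (≡.subst (b ∈ₗ_) (≡.sym eq) (∈-++⁺ʳ l (here ≡.refl))))
    ...   | here b≡c  = ≡.sym b≡c
    ...   | there b∈x = ⊥-elim (b∉x b∈x)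
    ¬R : ∀ {d} → d ∈ₗ x → ¬ R b d
    ¬R {d} d∈x r with ends d r
    ... | l , eq with ∷≡∷ʳ l (≡.trans (≡.sym (List.filter-accept (among? b d) (inj₁ c≡b))) eq)
    ...   | inj₁ (πx≡[] , _) = ∈⇒≢[] (∈-filter⁺ (among? b d) d∈x (inj₂ ≡.refl)) πx≡[]
    ...   | inj₂ (m , eq′) = b∉x (proj₁ (∈-filter⁻ (among? b d) {xs = x}
                               (≡.subst (b ∈ₗ_) (≡.sym eq′) (∈-++⁺ʳ m (here ≡.refl)))))

  ∼∷ʳ⇒Maximal : ∀ {x y b} → x ∼ y ∷ʳ b → Maximal b x
  ∼∷ʳ⇒Maximal {x} {y} {b} x∼yb = π-ends⇒Maximal x λ d r → π b d y , (begin
    π b d x                  ≡⟨ x∼yb b d r ⟩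
    π b d (y ∷ʳ b)           ≡⟨ List.filter-++ (among? b d) y [ b ] ⟩
    π b d y ++ π b d [ b ]   ≡⟨ ≡.cong (π b d y ++_) (List.filter-accept (among? b d) (inj₁ ≡.refl)) ⟩
    π b d y ∷ʳ b             ∎)

  Max⇒Maximal : ∀ {x b} → Max x b → Maximal b x
  Max⇒Maximal (y , x≋yb) = ∼∷ʳ⇒Maximal {y = y} (≋⇒∼ x≋yb)

  -- Induction on y from the right: the last letter of y ends every projection to a related pair
  -- containing it, hence is maximal in x too, can be moved to the end of x, and is cancelled on
  -- both sides.
  ∼⇒≋ : ∀ {x y} → x ∼ y → x ≋ y
  ∼⇒≋ {y = y} = go (reverseView y)
    where
    go : ∀ {x y} → Reverse y → x ∼ y → x ≋ y
    go {[]}    [] _   = ≋-refl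
    go {c ∷ x} [] x∼y with () ← ≡.trans (≡.sym (List.filter-accept (among? c c) {xs = x} (inj₁ ≡.refl))) (x∼y c c R-refl)
    go (y ∶ ys ∶ʳ b) x∼yb with Maximal⇒≋∷ʳ (∼∷ʳ⇒Maximal {y = y} x∼yb)
    ... | x′ , x≋x′b = ≋-trans x≋x′b (≋-cong (go ys (∼-cancelʳ [ b ] x′ y λ a c r →
            ≡.trans (≡.sym (≋⇒∼ x≋x′b a c r)) (x∼yb a c r))) ≋-refl)

  ≋-cancelˡ : ∀ x {y z} → x ++ y ≋ x ++ z → y ≋ z
  ≋-cancelˡ x {y} {z} eq = ∼⇒≋ (∼-cancelˡ x y z (≋⇒∼ eq))

  ≋-cancelʳ : ∀ x {y z} → y ++ x ≋ z ++ x → y ≋ z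
  ≋-cancelʳ x {y} {z} eq = ∼⇒≋ (∼-cancelʳ x y z (≋⇒∼ eq))

  ≋-reflexive : ∀ {x y} → x ≡ y → x ≋ y
  ≋-reflexive ≡.refl = ≋-refl

  -- Equality of traces is a finite check on projections. This is what allows repetitions to be
  -- removed from lists of traces.
  _≋?_ : Decidable _≋_
  x ≋? y = map′ ∼⇒≋ ≋⇒∼ (Fin.all? λ a → Fin.all? λ b →
    R? a b →-dec List.≡-dec Fin._≟_ (π a b x) (π a b y))

  decSetoid : DecSetoid 0ℓ 0ℓ
  decSetoid = record
    { isDecEquivalence = record
      { isEquivalence = record { refl = ≋-refl ; sym = ≋-sym ; trans = ≋-trans }
      ; _≟_ = _≋?_ } }

  ≋⇒↭ : ∀ {x y} → x ≋ y → x ↭ y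
  ≋⇒↭ ≋-refl                = ↭.refl
  ≋⇒↭ (≋-sym x≋y)           = ↭.↭-sym (≋⇒↭ x≋y)
  ≋⇒↭ (≋-trans x≋y y≋z)     = ↭.trans (≋⇒↭ x≋y) (≋⇒↭ y≋z)
  ≋⇒↭ (≋-cong x≋x′ y≋y′)    = ↭.++⁺ (≋⇒↭ x≋x′) (≋⇒↭ y≋y′)
  ≋⇒↭ (≋-swap _)            = ↭.swap _ _ ↭.refl

  ≋-length : ∀ {x y} → x ≋ y → length x ≡ length y
  ≋-length x≋y = ↭.↭-length (≋⇒↭ x≋y)

  count : Fin n → Trace → ℕ
  count a x = length (filter (Fin._≟ a) x)

  ≋-count : ∀ {a x y} → x ≋ y → count a x ≡ count a y
  ≋-count {a} x≋y = ↭.↭-length (↭.filter-↭ (Fin._≟ a) (≋⇒↭ x≋y))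

  count-++ : ∀ a x {y} → count a (x ++ y) ≡ count a x ℕ.+ count a y
  count-++ a x {y} = ≡.trans (≡.cong length (List.filter-++ (Fin._≟ a) x y))
                             (List.length-++ (filter (Fin._≟ a) x))

  count-∷ʳ : ∀ a x → count a (x ∷ʳ a) ≡ suc (count a x)
  count-∷ʳ a x = ≡.trans (count-++ a x) (≡.trans
    (≡.cong (λ y → count a x ℕ.+ length y) (List.filter-accept (Fin._≟ a) {xs = []} ≡.refl))
    (ℕ.+-comm (count a x) 1))

  count-∉ : ∀ {a x} → All (_≢ a) x → count a x ≡ 0
  count-∉ {a} x≢a = ≡.cong length (List.filter-none (Fin._≟ a) x≢a)

  𝓜⇒All : ∀ {S x} → 𝓜 S x → All (_∈ S) x
  𝓜⇒All (w , w∈S , x≋w) = ↭.All-resp-↭ (↭.↭-sym (≋⇒↭ x≋w)) w∈S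

  All⇒𝓜 : ∀ {S x} → All (_∈ S) x → 𝓜 S x
  All⇒𝓜 {x = x} x∈S = x , x∈S , ≋-refl

  𝓜-resp : ∀ {S} → 𝓜 S Respects _≋_
  𝓜-resp x≋y (w , w∈S , x≋w) = w , w∈S , ≋-trans (≋-sym x≋y) x≋w

  𝓜-++⁺ : ∀ {S x y} → 𝓜 S x → 𝓜 S y → 𝓜 S (x ++ y)
  𝓜-++⁺ x∈S y∈S = All⇒𝓜 (All.++⁺ (𝓜⇒All x∈S) (𝓜⇒All y∈S))

  𝓜-mono : ∀ {S T} → S ⊆ T → ∀ {x} → 𝓜 S x → 𝓜 T x
  𝓜-mono S⊆T x∈S = All⇒𝓜 (All.map S⊆T (𝓜⇒All x∈S))

  𝓜-∁-count : ∀ {a x} → 𝓜 (∁ ⁅ a ⁆) x → count a x ≡ 0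
  𝓜-∁-count {a} x∈ = count-∉ (All.map
    (λ c∈ c≡a → Subset.x∈∁p⇒x∉p c∈ (≡.subst (_∈ ⁅ a ⁆) (≡.sym c≡a) (Subset.x∈⁅x⁆ a))) (𝓜⇒All x∈))

  Max-resp : ∀ {b x y} → x ≋ y → Max x b → Max y b
  Max-resp x≋y (z , x≋zb) = z , ≋-trans (≋-sym x≋y) x≋zb

  Max⊆-resp : ∀ {T} → Max⊆ T Respects _≋_
  Max⊆-resp x≋y x⊆T m = x⊆T (Max-resp (≋-sym x≋y) m)

  Max⊆-[] : ∀ {T} → Max⊆ T []
  Max⊆-[] m = ⊥-elim (Max⇒Maximal m)

  Max-++ʳ : ∀ x {y b} → Max y b → Max (x ++ y) b
  Max-++ʳ x {b = b} (z , y≋zb) = x ++ z ,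
    ≋-trans (≋-cong (≋-refl {x}) y≋zb) (≋-reflexive (≡.sym (List.++-assoc x z [ b ])))

  ∈𝓛⇒R : ∀ {a b} → b ∈ 𝓛 a → R a b
  ∈𝓛⇒R {a} {b} b∈𝓛 with R? a b | ≡.trans (≡.sym (Vec.lookup∘tabulate (isYes ∘ R? a) b)) (Vec.[]=⇒lookup b∈𝓛)
  ... | yes r | _ = r
  ... | no _  | ()

  R⇒∈𝓛 : ∀ {a b} → R a b → b ∈ 𝓛 a
  R⇒∈𝓛 {a} {b} r = Vec.lookup⇒[]= b (𝓛 a) (≡.trans (Vec.lookup∘tabulate (isYes ∘ R? a) b) go)
    where
    go : isYes (R? a b) ≡ _
    go with R? a b
    ... | yes _ = ≡.refl
    ... | no ¬r = ⊥-elim (¬r r)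

  -- Pyramids and the uniqueness of factorizations.

  -- The alphabet below the apex is a parameter, for the sake of the induction on alphabets; `Pyr a`
  -- is `PyrIn (∁ ⁅ a ⁆) a` by definition.
  PyrIn : Subset n → Fin n → Pred Trace 0ℓ
  PyrIn S a x = ∃[ z ] 𝓜 S z × Max⊆ (𝓛 a) z × x ≋ z ∷ʳ a

  PyrIn-mono : ∀ {S T} → S ⊆ T → ∀ {a x} → PyrIn S a x → PyrIn T a x
  PyrIn-mono S⊆T (z , z∈S , z⊆𝓛 , x≋za) = z , 𝓜-mono S⊆T z∈S , z⊆𝓛 , x≋za

  -- A maximal letter of z · a other than the apex would be maximal in z and unrelated to a, but the
  -- maximal letters of z are related to a.
  Pyr-Max : ∀ {S a u b} → PyrIn S a u → Max u b → b ≡ a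
  Pyr-Max (z , _ , z⊆𝓛 , u≋za) m with Maximal-++⁻ z (Max⇒Maximal (Max-resp u≋za m))
  ... | inj₁ (inj₂ (a≡b , _))  = ≡.sym a≡b
  ... | inj₂ (mz , ¬Rba ∷ []) = ⊥-elim (¬Rba (R-sym (∈𝓛⇒R (z⊆𝓛 (Maximal⇒≋∷ʳ mz)))))

  Pyr-count : ∀ {a u} → Pyr a u → count a u ≡ 1
  Pyr-count {a} (z , z∈ , _ , u≋za) = ≡.trans (≋-count u≋za)
    (≡.trans (count-∷ʳ a z) (≡.cong suc (𝓜-∁-count z∈)))

  -- A maximal letter of the product comes from y or is maximal in the pyramid u, in which case it
  -- is the apex. This is where a ∈ T enters.
  Pyr-++-Max⊆ : ∀ {S a T u y} → a ∈ T → PyrIn S a u → Max⊆ T y → Max⊆ T (u ++ y)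
  Pyr-++-Max⊆ {u = u} a∈T pu y⊆T m with Maximal-++⁻ u (Max⇒Maximal m)
  ... | inj₁ my        = y⊆T (Maximal⇒≋∷ʳ my)
  ... | inj₂ (mu , _)  with ≡.refl ← Pyr-Max pu (Maximal⇒≋∷ʳ mu) = a∈T

  Max⊆-++ʳ⁻ : ∀ {T} x {y} → Max⊆ T (x ++ y) → Max⊆ T y
  Max⊆-++ʳ⁻ x xy⊆T m = xy⊆T (Max-++ʳ x m)

  -- The letters of y are cancelled from the right. The last one is maximal in v ++ z. If it belongs
  -- to z, it is cancelled there. Otherwise it is the apex of v and z contains no a, so the left
  -- side has two a's and the right side only one. When y is used up, a last letter of z would be
  -- the apex of u, and counting a's excludes it again.
  Pyr-++-injectiveˡ : ∀ {a u v y z} → Pyr a u → Pyr a v → u ++ y ≋ v ++ z → u ≋ v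
  Pyr-++-injectiveˡ {a} {u} {v} {y} pu pv = go (reverseView y)
    where
    go : ∀ {y z} → Reverse y → u ++ y ≋ v ++ z → u ≋ v
    go {z = z} [] u≋vz with reverseView z
    ... | [] = ≋-trans (≋-reflexive (≡.sym (List.++-identityʳ u)))
                 (≋-trans u≋vz (≋-reflexive (List.++-identityʳ v)))
    ... | z′ ∶ _ ∶ʳ c with ≡.refl ← Pyr-Max pu (Max-resp (≋-sym (≋-trans (≋-reflexive
                               (≡.sym (List.++-identityʳ u))) u≋vz)) (Max-++ʳ v (z′ , ≋-refl)))
      with () ← (begin
        1                                    ≡⟨ Pyr-count pu ⟨
        count a u                            ≡⟨ ≡.cong (count a) (List.++-identityʳ u) ⟨
        count a (u ++ [])                    ≡⟨ ≋-count u≋vz ⟩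
        count a (v ++ (z′ ∷ʳ a))             ≡⟨ count-++ a v ⟩
        count a v ℕ.+ count a (z′ ∷ʳ a)      ≡⟨ ≡.cong₂ ℕ._+_ (Pyr-count pv) (count-∷ʳ a z′) ⟩
        2 ℕ.+ count a z′                     ∎)
    go {z = z} (y ∶ ys ∶ʳ b) uyb≋vz with Maximal-++⁻ v (Max⇒Maximal (Max-resp uyb≋vz (Max-++ʳ u (y , ≋-refl))))
    ... | inj₁ mz with Maximal⇒≋∷ʳ mz
    ...   | z′ , z≋z′b = go ys (≋-cancelʳ [ b ] (≋-trans (≋-reflexive (List.++-assoc u y [ b ]))
            (≋-trans uyb≋vz (≋-trans (≋-cong (≋-refl {v}) z≋z′b) (≋-reflexive (≡.sym (List.++-assoc v z′ [ b ])))))))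
    go {z = z} (y ∶ ys ∶ʳ b) uyb≋vz | inj₂ (mv , ¬Rz) with ≡.refl ← Pyr-Max pv (Maximal⇒≋∷ʳ mv)
      with () ← (begin
        1                                    ≡⟨ ≡.cong₂ ℕ._+_ (Pyr-count pv)
                                                  (count-∉ (All.map (λ { ¬r ≡.refl → ¬r R-refl }) ¬Rz)) ⟨
        count a v ℕ.+ count a z              ≡⟨ count-++ a v ⟨
        count a (v ++ z)                     ≡⟨ ≋-count uyb≋vz ⟨
        count a (u ++ (y ∷ʳ a))              ≡⟨ count-++ a u ⟩
        count a u ℕ.+ count a (y ∷ʳ a)       ≡⟨ ≡.cong₂ ℕ._+_ (Pyr-count pu) (count-∷ʳ a y) ⟩
        2 ℕ.+ count a y                      ∎)

  -- A letter put in front of a pyramid joins it, unless it is unrelated to all of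
  -- its letters: then it moves past the pyramid.
  Pyr-split : ∀ {S} a x → 𝓜 S x → 𝓜 (S ∩ ∁ ⁅ a ⁆) x ⊎
              ∃[ u ] ∃[ y ] PyrIn (S ∩ ∁ ⁅ a ⁆) a u × 𝓜 S y × x ≋ u ++ y
  Pyr-split a [] _ = inj₁ (All⇒𝓜 [])
  Pyr-split {S} a (c ∷ x) cx∈S with 𝓜⇒All cx∈S | c Fin.≟ a
  ... | _ ∷ x∈S | yes ≡.refl = inj₂ ([ a ] , x ,
          ([] , All⇒𝓜 [] , Max⊆-[] , ≋-refl) , All⇒𝓜 x∈S , ≋-refl)
  ... | c∈S ∷ x∈S | no c≢a with Pyr-split a x (All⇒𝓜 x∈S)
  ...   | inj₁ x∈ = inj₁ (All⇒𝓜 (c∈ ∷ 𝓜⇒All x∈))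
    where
    c∈ : c ∈ S ∩ ∁ ⁅ a ⁆
    c∈ = Subset.x∈p∩q⁺ (c∈S , Subset.x∉p⇒x∈∁p (Subset.x≢y⇒x∉⁅y⁆ c≢a))
  ...   | inj₂ (u , y , (z , z∈ , z⊆𝓛 , u≋za) , y∈S , x≋uy) = inj₂ go
    where
    c∈ : c ∈ S ∩ ∁ ⁅ a ⁆
    c∈ = Subset.x∈p∩q⁺ (c∈S , Subset.x∉p⇒x∈∁p (Subset.x≢y⇒x∉⁅y⁆ c≢a))
    absorb : (∀ {b} → c ≡ b → All (λ d → ¬ R b d) z → b ∈ 𝓛 a) →
             ∃[ u ] ∃[ y ] PyrIn (S ∩ ∁ ⁅ a ⁆) a u × 𝓜 S y × c ∷ x ≋ u ++ y
    absorb c∈𝓛 = c ∷ u , y , (c ∷ z , All⇒𝓜 (c∈ ∷ 𝓜⇒All z∈) , cz⊆𝓛 , ≋-cong (≋-refl {[ c ]}) u≋za) ,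
                 y∈S , ≋-cong (≋-refl {[ c ]}) x≋uy
      where
      cz⊆𝓛 : Max⊆ (𝓛 a) (c ∷ z)
      cz⊆𝓛 m with Max⇒Maximal m
      ... | inj₁ mz         = z⊆𝓛 (Maximal⇒≋∷ʳ mz)
      ... | inj₂ (c≡b , ¬R) = c∈𝓛 c≡b ¬R
    go : ∃[ u ] ∃[ y ] PyrIn (S ∩ ∁ ⁅ a ⁆) a u × 𝓜 S y × c ∷ x ≋ u ++ y
    go with R? a c | all? (λ d → ¬? (R? c d)) z
    ... | yes r | _     = absorb λ { ≡.refl _ → R⇒∈𝓛 r }
    ... | no _  | no ¬z = absorb λ { ≡.refl ¬R → ⊥-elim (¬z ¬R) }
    ... | no ¬r | yes ¬R = u , c ∷ y , (z , z∈ , z⊆𝓛 , u≋za) , All⇒𝓜 (c∈S ∷ 𝓜⇒All y∈S) ,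
      ≋-trans (≋-cong (≋-refl {[ c ]}) x≋uy)
      (≋-trans (≋-cong (≋-trans (≋-cong (≋-refl {[ c ]}) u≋za)
                         (≋-trans (∷-commute (All.++⁺ ¬R ((λ r → ¬r (R-sym r)) ∷ [])))
                                  (≋-cong (≋-sym u≋za) ≋-refl))) (≋-refl {y}))
               (≋-reflexive (List.++-assoc u [ c ] y)))

  IsDecomposition-cons : ∀ {a x k u} → IsDecomposition a x (suc k) u →
    let y = concat (applyUpTo (u ∘ suc) (suc k)) in
    Pyr a (u 0) × IsDecomposition a y k (u ∘ suc) × x ≋ u 0 ++ y
  IsDecomposition-cons (pyr , last , x≋) =
    pyr 0 (s≤s z≤n) , ((λ i i<k → pyr (suc i) (s≤s i<k)) , last , ≋-refl) , x≋

  IsDecomposition-resp : ∀ {a x y k u} → x ≋ y → IsDecomposition a x k u → IsDecomposition a y k u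
  IsDecomposition-resp x≋y (pyr , last , x≋) = pyr , last , ≋-trans (≋-sym x≋y) x≋

  IsDecomposition-count : ∀ {a x} k {u} → IsDecomposition a x k u → k ≡ count a x
  IsDecomposition-count {a} zero {u} (_ , last , x≋) = ≡.sym (≡.trans (≋-count x≋)
    (≡.trans (≡.cong (count a) (List.++-identityʳ (u 0))) (𝓜-∁-count last)))
  IsDecomposition-count {a} (suc k) {u} dec with IsDecomposition-cons dec
  ... | pu , dec′ , x≋ = ≡.sym (≡.trans (≋-count x≋) (≡.trans (count-++ a (u 0))
          (≡.cong₂ ℕ._+_ (Pyr-count pu) (≡.sym (IsDecomposition-count k dec′)))))

  IsDecomposition-unique : ∀ {a x} k {u v} → IsDecomposition a x k u → IsDecomposition a x k v →
                           ∀ i → i ℕ.≤ k → u i ≋ v i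
  IsDecomposition-unique zero {u} {v} (_ , _ , x≋u) (_ , _ , x≋v) zero _ =
    ≋-trans (≋-reflexive (≡.sym (List.++-identityʳ (u 0))))
      (≋-trans (≋-sym x≋u) (≋-trans x≋v (≋-reflexive (List.++-identityʳ (v 0)))))
  IsDecomposition-unique (suc k) {u} {v} du dv i i≤k
    with IsDecomposition-cons du | IsDecomposition-cons dv
  ... | pu , du′ , x≋u | pv , dv′ , x≋v with Pyr-++-injectiveˡ pu pv (≋-trans (≋-sym x≋u) x≋v)
  ...   | u₀≋v₀ with i | i≤k
  ...     | zero  | _         = u₀≋v₀
  ...     | suc j | s≤s j≤k = IsDecomposition-unique k du′ (IsDecomposition-resp (≋-cancelˡ (v 0)
              (≋-trans (≋-sym x≋v) (≋-trans x≋u (≋-cong u₀≋v₀ ≋-refl)))) dv′) j j≤k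

-- Weights of sets of traces as suprema of finite sums.

module Weights (ℝ : CompleteOrderedField)
               {n : ℕ} (R : Rel (Fin n) 0ℓ) (R? : Decidable R)
               (R-refl : Reflexive R) (R-sym : Symmetric R)
               (p : CompleteOrderedField.Carrier ℝ)
               (0<p : CompleteOrderedField._<_ ℝ (CompleteOrderedField.0# ℝ) p) where
  open CompleteOrderedField ℝ hiding (zero)
  open Reals ℝ
  open Traces R R?
  open TraceTheory R R? R-refl R-sym
  open Exp semiring using (^-homo-*)

  Unique : List Trace → Set
  Unique = UniqueSetoid.Unique traceSetoid

  weight : Trace → Carrier
  weight x = p ^ length x

  total : List Trace → Carrier
  total xs = sumList (map weight xs)

  weight-pos : ∀ x → 0# < weight x
  weight-pos x = ^-pos 0<p (length x)

  weight-cong : ∀ {x y} → x ≋ y → weight x ≈ weight y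
  weight-cong x≋y = reflexive (≡.cong (p ^_) (≋-length x≋y))

  weight-++ : ∀ x y → weight (x ++ y) ≈ weight x * weight y
  weight-++ x y = trans (reflexive (≡.cong (p ^_) (List.length-++ x))) (^-homo-* p (length x) (length y))

  total-nonneg : ∀ xs → 0# ≤ total xs
  total-nonneg []       = ≤-refl
  total-nonneg (x ∷ xs) = +-nonneg (<⇒≤ (weight-pos x)) (total-nonneg xs)

  total-++ : ∀ xs ys → total (xs ++ ys) ≈ total xs + total ys
  total-++ []       ys = sym (+-identityˡ _)
  total-++ (x ∷ xs) ys = trans (+-congˡ (total-++ xs ys)) (sym (+-assoc _ _ _))

  total-map-++ : ∀ x ys → total (map (x ++_) ys) ≈ weight x * total ys
  total-map-++ x []       = sym (zeroʳ _)
  total-map-++ x (y ∷ ys) = trans (+-cong (weight-++ x y) (total-map-++ x ys)) (sym (distribˡ _ _ _))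

  total-cartesian : ∀ xs ys → total (cartesianProductWith _++_ xs ys) ≈ total xs * total ys
  total-cartesian []       ys = sym (zeroˡ _)
  total-cartesian (x ∷ xs) ys = begin-equality
    total (map (x ++_) ys ++ cartesianProductWith _++_ xs ys)   ≈⟨ total-++ (map (x ++_) ys) _ ⟩
    total (map (x ++_) ys) + total (cartesianProductWith _++_ xs ys)
      ≈⟨ +-cong (total-map-++ x ys) (total-cartesian xs ys) ⟩
    weight x * total ys + total xs * total ys                   ≈⟨ distribʳ _ _ _ ⟨
    total (x ∷ xs) * total ys                                   ∎

  total-─ : ∀ {x ys} (x∈ys : Any (x ≋_) ys) → total ys ≈ weight x + total (ys ─ x∈ys)
  total-─ (here x≋y) = +-congʳ (sym (weight-cong x≋y))
  total-─ {x} {y ∷ ys} (there x∈ys) = begin-equality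
    weight y + total ys                        ≈⟨ +-congˡ (total-─ x∈ys) ⟩
    weight y + (weight x + total (ys ─ x∈ys))
      ≈⟨ solve 3 (λ a b c → a :+ (b :+ c) := b :+ (a :+ c)) refl (weight y) (weight x) _ ⟩
    weight x + (weight y + total (ys ─ x∈ys))  ∎

  ∈-─ : ∀ {x z ys} → ¬ x ≋ z → (x∈ys : Any (x ≋_) ys) → Any (z ≋_) ys → Any (z ≋_) (ys ─ x∈ys)
  ∈-─ x≉z (here x≋y)   (here z≋y)   = ⊥-elim (x≉z (≋-trans x≋y (≋-sym z≋y)))
  ∈-─ x≉z (here x≋y)   (there z∈ys) = z∈ys
  ∈-─ x≉z (there x∈ys) (here z≋y)   = here z≋y
  ∈-─ x≉z (there x∈ys) (there z∈ys) = there (∈-─ x≉z x∈ys z∈ys)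

  -- Repetitions are allowed in ys: deleting an entry equal to x leaves entries for all traces
  -- different from x, and by uniqueness the remaining members of xs are such traces.
  total-⊆ : ∀ {xs} → Unique xs → ∀ {ys} → All (λ x → Any (x ≋_) ys) xs → total xs ≤ total ys
  total-⊆ [] {ys} [] = total-nonneg ys
  total-⊆ {x ∷ xs} (x∉xs ∷ xs!) {ys} (x∈ys ∷ xs⊆ys) = begin
    weight x + total xs               ≤⟨ +-mono-≤ ≤-refl (total-⊆ xs!
                                          (All.zipWith (λ (x≉z , z∈ys) → ∈-─ x≉z x∈ys z∈ys) (x∉xs , xs⊆ys))) ⟩
    weight x + total (ys ─ x∈ys)      ≈⟨ total-─ x∈ys ⟨
    total ys                          ∎

  FiniteSum : Pred Trace 0ℓ → Pred Carrier 0ℓ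
  FiniteSum A s = ∃[ xs ] Unique xs × All A xs × s ≈ total xs

  -- A relation rather than a function, since `sup` is unspecified as long as no bound is known.
  HasWeight : Pred Trace 0ℓ → Carrier → Set
  HasWeight A = IsSup (FiniteSum A)

  total-≤ : ∀ {A s} → HasWeight A s → ∀ {xs} → Unique xs → All A xs → total xs ≤ s
  total-≤ (ub , _) {xs} xs! xs∈A = ub (xs , xs! , xs∈A , refl)

  HasWeight-least : ∀ {A s b} → HasWeight A s → (∀ {xs} → Unique xs → All A xs → total xs ≤ b) → s ≤ b
  HasWeight-least (_ , least) xs≤b = least λ (_ , xs! , xs∈A , s≈) → ≤-trans (≤-reflexive s≈) (xs≤b xs! xs∈A)

  hasWeight : ∀ {A s} → (∀ {xs} → Unique xs → All A xs → total xs ≤ s) →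
              (∀ {b} → (∀ {xs} → Unique xs → All A xs → total xs ≤ b) → s ≤ b) → HasWeight A s
  hasWeight ub least = (λ (_ , xs! , xs∈A , s≈) → ≤-trans (≤-reflexive s≈) (ub xs! xs∈A)) ,
                       λ bound → least λ {xs} xs! xs∈A → bound (xs , xs! , xs∈A , refl)

  HasWeight-nonneg : ∀ {A s} → HasWeight A s → 0# ≤ s
  HasWeight-nonneg A≈s = total-≤ A≈s [] []

  HasWeight-≐ : ∀ {A B s} → A ≐ B → HasWeight A s → HasWeight B s
  HasWeight-≐ (A⊆B , B⊆A) A≈s = hasWeight
    (λ xs! xs∈B → total-≤ A≈s xs! (All.map B⊆A xs∈B))
    (λ bound → HasWeight-least A≈s λ xs! xs∈A → bound xs! (All.map A⊆B xs∈A))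

  HasWeight-unique : ∀ {A B s t} → A ≐ B → HasWeight A s → HasWeight B t → s ≈ t
  HasWeight-unique A≐B A≈s B≈t = sup-unique (HasWeight-≐ A≐B A≈s) B≈t

  Bounded : Pred Trace 0ℓ → Carrier → Set
  Bounded A b = ∀ {xs} → Unique xs → All A xs → total xs ≤ b

  HasWeight⇒Bounded : ∀ {A B s} → A U.⊆ B → HasWeight B s → Bounded A s
  HasWeight⇒Bounded A⊆B B≈s xs! xs∈A = total-≤ B≈s xs! (All.map A⊆B xs∈A)

  sup-hasWeight : ∀ {A b} → Bounded A b → HasWeight A (sup (FiniteSum A))
  sup-hasWeight {A} {b} A≤b = sup-isSup (0# , [] , [] , [] , refl)
    (b , λ (_ , xs! , xs∈A , s≈) → ≤-trans (≤-reflexive s≈) (A≤b xs! xs∈A))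

  HasWeight-singleton : ∀ z → HasWeight (_≋ z) (weight z)
  HasWeight-singleton z = hasWeight
    (λ xs! xs∈ → ≤-trans (total-⊆ xs! {[ z ]} (All.map here xs∈)) (≤-reflexive (+-identityʳ _)))
    (λ bound → ≤-trans (≤-reflexive (sym (+-identityʳ _))) (bound ([] ∷ []) (≋-refl ∷ [])))

  -- Different products may share a factor, so the lists of factors collected from distinct products
  -- can have repetitions, while the suprema range over lists without them.
  dedup : List Trace → List Trace
  dedup = deduplicate _≋?_

  dedup-! : ∀ xs → Unique (dedup xs)
  dedup-! = UniqueDecSetoid.deduplicate-! decSetoid

  ∈-dedup⁺ : ∀ {x xs} → Any (x ≋_) xs → Any (x ≋_) (dedup xs)
  ∈-dedup⁺ = SetoidMembership.∈-deduplicate⁺ traceSetoid _≋?_ (λ z≋y x≋y → ≋-trans x≋y (≋-sym z≋y))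

  ∪-split : ∀ {A B : Pred Trace 0ℓ} {xs} → All (A U.∪ B) xs →
    ∃[ ys ] ∃[ zs ] All A ys × All B zs × All (λ x → Any (x ≋_) ys ⊎ Any (x ≋_) zs) xs
  ∪-split [] = [] , [] , [] , [] , []
  ∪-split (_∷_ {x} (inj₁ a) xs∈) with ∪-split xs∈
  ... | ys , zs , ys∈A , zs∈B , cover = x ∷ ys , zs , a ∷ ys∈A , zs∈B ,
        inj₁ (here ≋-refl) ∷ All.map (λ { (inj₁ i) → inj₁ (there i) ; (inj₂ j) → inj₂ j }) cover
  ∪-split (_∷_ {x} (inj₂ b) xs∈) with ∪-split xs∈
  ... | ys , zs , ys∈A , zs∈B , cover = ys , x ∷ zs , ys∈A , b ∷ zs∈B ,
        inj₂ (here ≋-refl) ∷ All.map (λ { (inj₁ i) → inj₁ i ; (inj₂ j) → inj₂ (there j) }) cover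

  HasWeight-∪ : ∀ {A B s t} → (∀ {x y} → A x → B y → ¬ x ≋ y) →
                HasWeight A s → HasWeight B t → HasWeight (A U.∪ B) (s + t)
  HasWeight-∪ {A} {B} {s} {t} disjoint A≈s B≈t = hasWeight bound least
    where
    bound : Bounded (A U.∪ B) (s + t)
    bound {xs} xs! xs∈ with ∪-split xs∈
    ... | ys , zs , ys∈A , zs∈B , cover = begin
      total xs                            ≤⟨ total-⊆ xs! (All.map (λ where
                                              (inj₁ i) → SetoidMembership.∈-++⁺ˡ traceSetoid (∈-dedup⁺ i)
                                              (inj₂ j) → SetoidMembership.∈-++⁺ʳ traceSetoid (dedup ys) (∈-dedup⁺ j)) cover) ⟩
      total (dedup ys ++ dedup zs)        ≈⟨ total-++ (dedup ys) (dedup zs) ⟩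
      total (dedup ys) + total (dedup zs) ≤⟨ +-mono-≤
                                              (total-≤ A≈s (dedup-! ys) (All.deduplicate⁺ _≋?_ ys∈A))
                                              (total-≤ B≈t (dedup-! zs) (All.deduplicate⁺ _≋?_ zs∈B)) ⟩
      s + t                               ∎
    -- The two suprema are taken one after the other: for a fixed list ys in B, the sums over A give
    -- s ≤ b - total ys, and then the sums over B give t ≤ b - s.
    least : ∀ {b} → Bounded (A U.∪ B) b → s + t ≤ b
    least {b} A∪B≤b = ≤-by (≤⇒0≤- t≤) (solve 3 (λ s t b → b :- s :- t := b :- (s :+ t)) refl s t b)
      where
      joint : ∀ {xs ys} → Unique xs → All A xs → Unique ys → All B ys → total xs + total ys ≤ b
      joint {xs} {ys} xs! xs∈A ys! ys∈B = ≤-trans (≤-reflexive (sym (total-++ xs ys)))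
        (A∪B≤b (AllPairs.++⁺ xs! ys! (All.map (λ a → All.map (disjoint a) ys∈B) xs∈A))
               (All.++⁺ (All.map inj₁ xs∈A) (All.map inj₂ ys∈B)))
      t≤ : t ≤ b - s
      t≤ = HasWeight-least B≈t λ {ys} ys! ys∈B → +-cancelˡ-≤ (≤-trans (≤-reflexive (+-comm _ _))
        (≤-by (≤⇒0≤- (HasWeight-least A≈s λ {xs} xs! xs∈A →
            +-cancelˡ-≤ (≤-trans (≤-reflexive (+-comm _ _)) (joint xs! xs∈A ys! ys∈B))))
          (solve 3 (λ s y b → b :- y :- s := b :- (y :+ s)) refl s (total ys) b)))

  infixl 7 _·_
  _·_ : Pred Trace 0ℓ → Pred Trace 0ℓ → Pred Trace 0ℓ
  (A · B) z = ∃[ x ] ∃[ y ] A x × B y × z ≋ x ++ y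

  ·-split : ∀ {A B zs} → All (A · B) zs →
    ∃[ xs ] ∃[ ys ] All A xs × All B ys ×
    All (λ z → ∃[ x ] ∃[ y ] Any (x ≋_) xs × Any (y ≋_) ys × z ≋ x ++ y) zs
  ·-split [] = [] , [] , [] , [] , []
  ·-split ((x , y , a , b , z≋xy) ∷ zs∈) with ·-split zs∈
  ... | xs , ys , xs∈A , ys∈B , cover = x ∷ xs , y ∷ ys , a ∷ xs∈A , b ∷ ys∈B ,
        (x , y , here ≋-refl , here ≋-refl , z≋xy) ∷
        All.map (λ (x , y , x∈ , y∈ , eq) → x , y , there x∈ , there y∈ , eq) cover

  All-cartesian : ∀ {A B C : Pred Trace 0ℓ} → (∀ {x y} → A x → B y → C (x ++ y)) →
                  ∀ {xs ys} → All A xs → All B ys → All C (cartesianProductWith _++_ xs ys)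
  All-cartesian f []           ys∈B = []
  All-cartesian f (a ∷ xs∈A) ys∈B = All.++⁺ (All.map⁺ (All.map (f a) ys∈B)) (All-cartesian f xs∈A ys∈B)

  -- It is enough that the product determines the left factor; the right one follows by left
  -- cancellation in the trace monoid.
  Unique-cartesian : ∀ {A B : Pred Trace 0ℓ} →
    (∀ {x x′ y y′} → A x → A x′ → B y → B y′ → x ++ y ≋ x′ ++ y′ → x ≋ x′) →
    ∀ {xs ys} → Unique xs → All A xs → Unique ys → All B ys → Unique (cartesianProductWith _++_ xs ys)
  Unique-cartesian injˡ [] [] ys! ys∈B = []
  Unique-cartesian injˡ {x ∷ xs} (x∉xs ∷ xs!) (a ∷ xs∈A) ys! ys∈B = AllPairs.++⁺
    (UniqueSetoid.map⁺ traceSetoid traceSetoid (≋-cancelˡ x) ys!)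
    (Unique-cartesian injˡ xs! xs∈A ys! ys∈B)
    (All.map⁺ (All.map (λ b → All-cartesian (λ (a′ , x≉x′) b′ eq → x≉x′ (injˡ a a′ b b′ eq))
                                (All.zip (xs∈A , x∉xs)) ys∈B) ys∈B))

  HasWeight-· : ∀ {A B s t} → (∀ {x x′ y y′} → A x → A x′ → B y → B y′ → x ++ y ≋ x′ ++ y′ → x ≋ x′) →
                HasWeight A s → HasWeight B t → HasWeight (A · B) (s * t)
  HasWeight-· {A} {B} {s} {t} injˡ A≈s B≈t = hasWeight bound least
    where
    bound : Bounded (A · B) (s * t)
    bound {zs} zs! zs∈ with ·-split zs∈
    ... | xs , ys , xs∈A , ys∈B , cover = begin
      total zs                              ≤⟨ total-⊆ zs! (All.map (λ (x , y , x∈ , y∈ , z≋xy) →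
                                                Any.map (≋-trans z≋xy)
                                                  (SetoidMembership.∈-cartesianProductWith⁺ traceSetoid traceSetoid traceSetoid
                                                    ≋-cong (∈-dedup⁺ x∈) (∈-dedup⁺ y∈))) cover) ⟩
      total (cartesianProductWith _++_ (dedup xs) (dedup ys)) ≈⟨ total-cartesian (dedup xs) (dedup ys) ⟩
      total (dedup xs) * total (dedup ys)   ≤⟨ *-monoʳ-≤ (total-nonneg (dedup ys))
                                                (total-≤ A≈s (dedup-! xs) (All.deduplicate⁺ _≋?_ xs∈A)) ⟩
      s * total (dedup ys)                  ≤⟨ *-monoˡ-≤ (HasWeight-nonneg A≈s)
                                                (total-≤ B≈t (dedup-! ys) (All.deduplicate⁺ _≋?_ ys∈B)) ⟩
      s * t                                 ∎
    least : ∀ {b} → Bounded (A · B) b → s * t ≤ b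
    least {b} AB≤b = *-sup-≤ B≈t (HasWeight-nonneg A≈s) 0≤b λ {v} (ys , ys! , ys∈B , v≈) → begin
      s * v             ≈⟨ trans (*-comm s v) (*-congʳ v≈) ⟩
      total ys * s      ≤⟨ *-sup-≤ A≈s (total-nonneg ys) 0≤b (λ {u} (xs , xs! , xs∈A , u≈) → begin
        total ys * u          ≈⟨ trans (*-congˡ u≈) (*-comm _ _) ⟩
        total xs * total ys   ≈⟨ total-cartesian xs ys ⟨
        total (cartesianProductWith _++_ xs ys)
                              ≤⟨ AB≤b (Unique-cartesian injˡ xs! xs∈A ys! ys∈B)
                                   (All-cartesian (λ a b → _ , _ , a , b , ≋-refl) xs∈A ys∈B) ⟩
        b                     ∎) ⟩
      b                 ∎
      where
      0≤b : 0# ≤ b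
      -- The empty list of products; `*-sup-≤` asks for this in view of vanishing coefficients.
      0≤b = AB≤b [] []

  -- X = X₀ ∪ U · X with a bound on its finite sums forces the weight s of X
  -- to satisfy s = z + r s.  The bound is obtained by grading X by a length
  -- function that increases by one at each factor from U.
  HasWeight-geometric : ∀ {X X₀ U r z} (size : Trace → ℕ) →
    (∀ {x y} → x ≋ y → size x ≡ size y) →
    (∀ {u y} → U u → size (u ++ y) ≡ suc (size y)) →
    X ≐ X₀ U.∪ U · X →
    (∀ {x} → X₀ x → size x ≡ 0) →
    (∀ {u u′ y y′} → U u → U u′ → u ++ y ≋ u′ ++ y′ → u ≋ u′) →
    r < 1# → HasWeight X₀ z → HasWeight U r → HasWeight X (z / (1# - r))
  HasWeight-geometric {X} {X₀} {U} {r} {z} size size-cong size-++ (X⊆ , ⊆X) size-X₀ injˡ r<1 X₀≈z U≈r =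
    IsSup-resp-≈ (sym (/-unique 1-r≉0 (begin-equality
      z               ≈⟨ solve 2 (λ z rs → z := z :+ rs :- rs) refl z (r * s) ⟩
      z + r * s - r * s  ≈⟨ +-congʳ (HasWeight-unique (X⊆ , ⊆X) X≈s (HasWeight-step X≈s)) ⟨
      s - r * s       ≈⟨ solve 2 (λ s r → s :- r :* s := s :* (con (pos 1) :- r)) refl s r ⟩
      s * (1# - r)    ∎))) X≈s
    where
    1-r≉0 : 1# - r ≉ 0#
    1-r≉0 = >⇒≉ (<⇒0<- r<1)
    -- The fixed point of t ↦ z + r t. Hence the bound b passes from `X< N` to `X< (suc N)`,
    -- starting from the empty set `X< 0`.
    b : Carrier
    b = z / (1# - r)
    HasWeight-step : ∀ {Y t} → HasWeight Y t → HasWeight (X₀ U.∪ U · Y) (z + r * t)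
    HasWeight-step Y≈t = HasWeight-∪
      (λ x₀ (u , y , u∈U , _ , x≋uy) x₀≋x → ℕ.0≢1+n (≡.trans (≡.sym (size-X₀ x₀))
         (≡.trans (size-cong (≋-trans x₀≋x x≋uy)) (size-++ u∈U))))
      X₀≈z (HasWeight-· (λ u∈ u′∈ _ _ → injˡ u∈ u′∈) U≈r Y≈t)
    X< : ℕ → Pred Trace 0ℓ
    X< N x = X x × size x ℕ.< N
    X<-step : ∀ {N} → X< (suc N) U.⊆ X₀ U.∪ U · X< N
    X<-step (x∈X , x<N) with X⊆ x∈X
    ... | inj₁ x₀ = inj₁ x₀
    ... | inj₂ (u , y , u∈U , y∈X , x≋uy) = inj₂ (u , y , u∈U ,
          (y∈X , ℕ.s≤s⁻¹ (≡.subst (ℕ._< _) (≡.trans (size-cong x≋uy) (size-++ u∈U)) x<N)) , x≋uy)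
    0≤b : 0# ≤ b
    0≤b = *-nonneg (HasWeight-nonneg X₀≈z) (<⇒≤ (⁻¹-pos (<⇒0<- r<1)))
    z+rb≈b : z + r * b ≈ b
    z+rb≈b = begin-equality
      z + r * b               ≈⟨ +-congʳ (/-* 1-r≉0) ⟨
      b * (1# - r) + r * b    ≈⟨ solve 2 (λ b r → b :* (con (pos 1) :- r) :+ r :* b := b) refl b r ⟩
      b                       ∎
    X<-bounded : ∀ N → Bounded (X< N) b
    X<-bounded zero    [] [] = 0≤b
    X<-bounded zero    (_ ∷ _) ((_ , ()) ∷ _)
    X<-bounded (suc N) {xs} xs! xs∈ = begin
      total xs            ≤⟨ total-≤ (HasWeight-step (sup-hasWeight (X<-bounded N))) xs! (All.map X<-step xs∈) ⟩
      z + r * t           ≤⟨ +-mono-≤ ≤-refl (*-monoˡ-≤ (HasWeight-nonneg U≈r)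
                               (HasWeight-least (sup-hasWeight (X<-bounded N)) (X<-bounded N))) ⟩
      z + r * b           ≈⟨ z+rb≈b ⟩
      b                   ∎
      where
      t : Carrier
      t = sup (FiniteSum (X< N))
    sizes : ∀ {xs} → All X xs → ∃[ N ] All (X< N) xs
    sizes [] = 0 , []
    sizes {x ∷ xs} (x∈X ∷ xs∈X) with sizes xs∈X
    ... | N , xs∈ = suc (size x) ℕ.⊔ N , (x∈X , ℕ.m≤m⊔n _ N) ∷
          All.map (λ (y∈X , y<N) → y∈X , ℕ.<-≤-trans y<N (ℕ.m≤n⊔m _ N)) xs∈
    X≈s : HasWeight X (sup (FiniteSum X))
    X≈s = sup-hasWeight {b = b} λ xs! xs∈X → let N , xs∈ = sizes xs∈X in X<-bounded N xs! xs∈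
    s : Carrier
    s = sup (FiniteSum X)

-- Positivity of a family of Lipschitz functions.

module Lipschitz (ℝ : CompleteOrderedField) (M : CompleteOrderedField.Carrier ℝ)
                 (0≤M : CompleteOrderedField._≤_ ℝ (CompleteOrderedField.0# ℝ) M) where
  open CompleteOrderedField ℝ hiding (zero)
  open Reals ℝ

  infix 4 ∣_∣≤_
  ∣_∣≤_ : Carrier → Carrier → Set
  ∣ x ∣≤ c = x ≤ c × - x ≤ c

  ∣+∣≤ : ∀ {x y c d} → ∣ x ∣≤ c → ∣ y ∣≤ d → ∣ x + y ∣≤ c + d
  ∣+∣≤ {x} {y} (x≤c , -x≤c) (y≤d , -y≤d) = +-mono-≤ x≤c y≤d ,
    ≤-trans (≤-reflexive (solve 2 (λ x y → :- (x :+ y) := :- x :+ :- y) refl x y)) (+-mono-≤ -x≤c -y≤d)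

  ∣-∣≤ : ∀ {x c} → ∣ x ∣≤ c → ∣ - x ∣≤ c
  ∣-∣≤ {x} (x≤c , -x≤c) = -x≤c , ≤-trans (≤-reflexive (solve 1 (λ x → :- (:- x) := x) refl x)) x≤c

  ∣*∣≤ : ∀ {a x c} → 0# ≤ a → ∣ x ∣≤ c → ∣ a * x ∣≤ a * c
  ∣*∣≤ {a} {x} 0≤a (x≤c , -x≤c) = *-monoˡ-≤ 0≤a x≤c ,
    ≤-trans (≤-reflexive (solve 2 (λ a x → :- (a :* x) := a :* (:- x)) refl a x)) (*-monoˡ-≤ 0≤a -x≤c)

  ∣∣≤-resp : ∀ {x y c d} → x ≈ y → c ≤ d → ∣ x ∣≤ c → ∣ y ∣≤ d
  ∣∣≤-resp x≈y c≤d (x≤c , -x≤c) =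
    ≤-trans (≤-reflexive (sym x≈y)) (≤-trans x≤c c≤d) ,
    ≤-trans (≤-reflexive (-‿cong (sym x≈y))) (≤-trans -x≤c c≤d)

  InRange : Carrier → Set
  InRange x = 0# ≤ x × x ≤ M

  -- A quantitative substitute for continuity on [0, M]. The constant also bounds the function
  -- itself, as needed for multiplication by x; taking x ≤ y avoids the absolute value of y - x.
  IsLipschitz : (Carrier → Carrier) → Set
  IsLipschitz f = ∃[ C ] 0# ≤ C ×
    (∀ {x} → InRange x → ∣ f x ∣≤ C) ×
    (∀ {x y} → InRange x → InRange y → x ≤ y → ∣ f y - f x ∣≤ C * (y - x))

  Lipschitz-const : ∀ {c} → 0# ≤ c → IsLipschitz λ _ → c
  Lipschitz-const {c} 0≤c = c , 0≤c , (λ _ → ≤-refl , -c≤c) , λ {x} {y} _ _ x≤y →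
    ∣∣≤-resp (sym (-‿inverseʳ c)) (*-nonneg 0≤c (≤⇒0≤- x≤y))
      (≤-refl , ≤-reflexive (solve 0 (:- con (pos 0) := con (pos 0)) refl))
    where
    -c≤c : - c ≤ c
    -c≤c = ≤-by (+-nonneg 0≤c 0≤c) (solve 1 (λ c → c :+ c := c :- :- c) refl c)

  Lipschitz-+ : ∀ {f g} → IsLipschitz f → IsLipschitz g → IsLipschitz λ x → f x + g x
  Lipschitz-+ {f} {g} (C , 0≤C , f≤ , Δf≤) (D , 0≤D , g≤ , Δg≤) = C + D , +-nonneg 0≤C 0≤D ,
    (λ x∈ → ∣+∣≤ (f≤ x∈) (g≤ x∈)) , λ {x} {y} x∈ y∈ x≤y →
    ∣∣≤-resp (solve 4 (λ a b c d → a :- b :+ (c :- d) := a :+ c :- (b :+ d)) refl (f y) (f x) (g y) (g x))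
             (≤-reflexive (sym (distribʳ _ C D)))
             (∣+∣≤ (Δf≤ x∈ y∈ x≤y) (Δg≤ x∈ y∈ x≤y))

  Lipschitz-neg : ∀ {f} → IsLipschitz f → IsLipschitz λ x → - f x
  Lipschitz-neg {f} (C , 0≤C , f≤ , Δf≤) = C , 0≤C , (λ x∈ → ∣-∣≤ (f≤ x∈)) , λ {x} {y} x∈ y∈ x≤y →
    ∣∣≤-resp (solve 2 (λ a b → :- (a :- b) := :- a :- :- b) refl (f y) (f x)) ≤-refl (∣-∣≤ (Δf≤ x∈ y∈ x≤y))

  -- y f(y) - x f(x) = y (f(y) - f(x)) + (y - x) f(x)
  Lipschitz-id* : ∀ {f} → IsLipschitz f → IsLipschitz λ x → x * f x
  Lipschitz-id* {f} (C , 0≤C , f≤ , Δf≤) = M * C + C , +-nonneg (*-nonneg 0≤M 0≤C) 0≤C ,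
    (λ {x} (0≤x , x≤M) → ∣∣≤-resp refl (≤-trans (*-monoʳ-≤ 0≤C x≤M) (x≤x+y 0≤C)) (∣*∣≤ 0≤x (f≤ (0≤x , x≤M)))) ,
    λ {x} {y} x∈ y∈@(0≤y , y≤M) x≤y →
    ∣∣≤-resp (solve 4 (λ x y a b → y :* (a :- b) :+ (y :- x) :* b := y :* a :- x :* b) refl x y (f y) (f x))
      (begin
        y * (C * (y - x)) + (y - x) * C   ≤⟨ +-mono-≤ (*-monoʳ-≤ (*-nonneg 0≤C (≤⇒0≤- x≤y)) y≤M) ≤-refl ⟩
        M * (C * (y - x)) + (y - x) * C   ≈⟨ solve 3 (λ M C d → M :* (C :* d) :+ d :* C := (M :* C :+ C) :* d) refl M C (y - x) ⟩
        (M * C + C) * (y - x)             ∎)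
      (∣+∣≤ (∣*∣≤ 0≤y (Δf≤ x∈ y∈ x≤y)) (∣*∣≤ (≤⇒0≤- x≤y) (f≤ x∈)))

  Lipschitz-cong : ∀ {f g} → (∀ x → f x ≈ g x) → IsLipschitz f → IsLipschitz g
  Lipschitz-cong f≈g (C , 0≤C , f≤ , Δf≤) = C , 0≤C , (λ {x} x∈ → ∣∣≤-resp (f≈g x) ≤-refl (f≤ x∈)) ,
    λ {x} {y} x∈ y∈ x≤y → ∣∣≤-resp (+-cong (f≈g y) (-‿cong (f≈g x))) ≤-refl (Δf≤ x∈ y∈ x≤y)

  PositiveNear : (Carrier → Carrier) → Carrier → Carrier → Set
  PositiveNear f q δ = ∀ {x} → InRange x → x - q ≤ δ → q - x ≤ δ → 0# < f x

  Lipschitz-pos : ∀ {f q} → IsLipschitz f → InRange q → 0# < f q → ∃[ δ ] 0# < δ × PositiveNear f q δ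
  Lipschitz-pos {f} {q} (C , 0≤C , _ , Δf≤) q∈ 0<fq = δ , 0<δ , near
    where
    0<C+1 : 0# < C + 1#
    0<C+1 = <-respʳ-≈ (+-comm 1# C) (+-pos-nonneg 0<1 0≤C)
    δ : Carrier
    -- The denominator C + 1 is positive even if C = 0, and it makes C δ strictly smaller than f q.
    δ = f q / (C + 1#)
    0<δ : 0# < δ
    0<δ = /-pos 0<fq 0<C+1
    Cδ<fq : C * δ < f q
    Cδ<fq = <-by 0<δ (begin-equality
      δ                       ≈⟨ solve 2 (λ δ C → δ := δ :* (C :+ con (pos 1)) :- C :* δ) refl δ C ⟩
      δ * (C + 1#) - C * δ    ≈⟨ +-congʳ (/-* (>⇒≉ 0<C+1)) ⟩
      f q - C * δ             ∎)
    close : ∀ {x d} → f q - f x ≤ C * d → d ≤ δ → 0# < f x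
    close {x} {d} Δ≤ d≤δ = <-by (<⇒0<- (begin-strict
      f q - f x   ≤⟨ Δ≤ ⟩
      C * d       ≤⟨ *-monoˡ-≤ 0≤C d≤δ ⟩
      C * δ       <⟨ Cδ<fq ⟩
      f q         ∎)) (solve 2 (λ a b → a :- (a :- b) := b :- con (pos 0)) refl (f q) (f x))
    near : PositiveNear f q δ
    near {x} x∈ x-q≤δ q-x≤δ with x ≤? q
    ... | yes x≤q = close (proj₁ (Δf≤ x∈ q∈ x≤q)) q-x≤δ
    ... | no x≰q  = close (≤-trans (≤-reflexive (solve 2 (λ a b → a :- b := :- (b :- a)) refl (f q) (f x)))
                      (proj₂ (Δf≤ q∈ x∈ (<⇒≤ (≰⇒> x≰q))))) x-q≤δ

  PositiveNear-≤ : ∀ {f q δ ε} → ε ≤ δ → PositiveNear f q δ → PositiveNear f q ε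
  PositiveNear-≤ ε≤δ near x∈ x-q≤ε q-x≤ε = near x∈ (≤-trans x-q≤ε ε≤δ) (≤-trans q-x≤ε ε≤δ)

  -- The last component carries positivity of both numbers over to the minimum.
  ∃-min : ∀ x y → ∃[ z ] z ≤ x × z ≤ y × (z ≡ x ⊎ z ≡ y)
  ∃-min x y with x ≤? y
  ... | yes x≤y = x , ≤-refl , x≤y , inj₁ ≡.refl
  ... | no x≰y  = y , <⇒≤ (≰⇒> x≰y) , ≤-refl , inj₂ ≡.refl

  PositiveNear-uniform : ∀ {m} {f : Subset m → Carrier → Carrier} {q} →
    (∀ S → ∃[ δ ] 0# < δ × PositiveNear (f S) q δ) → ∃[ δ ] 0# < δ × (∀ S → PositiveNear (f S) q δ)
  PositiveNear-uniform {zero} near with near Vec.[]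
  ... | δ , 0<δ , nearδ = δ , 0<δ , λ { Vec.[] → nearδ }
  PositiveNear-uniform {suc m} near
    with PositiveNear-uniform (near ∘ (outside Vec.∷_)) | PositiveNear-uniform (near ∘ (inside Vec.∷_))
  ... | δ , 0<δ , nearδ | ε , 0<ε , nearε with ∃-min δ ε
  ...   | z , z≤δ , z≤ε , which = z , 0<z which , λ where
            (outside Vec.∷ S) → PositiveNear-≤ z≤δ (nearδ S)
            (inside  Vec.∷ S) → PositiveNear-≤ z≤ε (nearε S)
    where
    0<z : z ≡ δ ⊎ z ≡ ε → 0# < z
    0<z (inj₁ ≡.refl) = 0<δ
    0<z (inj₂ ≡.refl) = 0<ε

  -- At the supremum q of the points up to which all members are positive, all
  -- members are nonnegative; if one of them vanished at q, so would f ⊤.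
  module PositiveFamily {n} (f : Subset n → Carrier → Carrier)
    (lip : ∀ S → IsLipschitz (f S)) (pos₀ : ∀ S → 0# < f S 0#)
    (f⊤-least : ∀ {q} → InRange q → (∀ S → 0# ≤ f S q) → ∀ S → f ⊤ q ≤ f S q)
    (f⊤≉0 : ∀ {q} → InRange q → f ⊤ q ≉ 0#) where
    Good : Pred Carrier 0ℓ
    Good q = InRange q × (∀ {x} → 0# ≤ x → x ≤ q → ∀ S → 0# < f S x)

    near-0 : ∀ {x} → x ≈ 0# → InRange x → ∀ S → 0# < f S x
    near-0 {x} x≈0 x∈ S with Lipschitz-pos (lip S) (≤-refl , 0≤M) (pos₀ S)
    ... | δ , 0<δ , near = near x∈
      (≤-trans (≤-reflexive (trans (+-congʳ x≈0) (-‿inverseʳ 0#))) (<⇒≤ 0<δ))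
      (≤-trans (≤-reflexive (trans (+-congˡ (-‿cong x≈0)) (-‿inverseʳ 0#))) (<⇒≤ 0<δ))

    good-0 : Good 0#
    good-0 = (≤-refl , 0≤M) , λ 0≤x x≤0 → near-0 (antisym x≤0 0≤x) (0≤x , ≤-trans x≤0 0≤M)

    q : Carrier
    q = sup Good

    q-isSup : IsSup Good q
    q-isSup = sup-isSup (0# , good-0) (M , λ ((_ , x≤M) , _) → x≤M)

    q∈ : InRange q
    q∈ = proj₁ q-isSup good-0 , proj₂ q-isSup λ ((_ , x≤M) , _) → x≤M

    -- If `f S x` were not positive, no good point could lie beyond x, and x would be an upper bound
    -- of `Good` smaller than its supremum.
    below-q : ∀ {x} → 0# ≤ x → x < q → ∀ S → 0# < f S x
    below-q {x} 0≤x x<q S = ≰⇒> λ fx≤0 → <⇒≱ x<q (proj₂ q-isSup λ {y} (_ , good-y) →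
      ≮⇒≥ λ x<y → <⇒≱ (good-y 0≤x (<⇒≤ x<y) S) fx≤0)

    nonneg-q : ∀ S → 0# ≤ f S q
    nonneg-q S = ≮⇒≥ not-negative
      where
      not-negative : ¬ f S q < 0#
      not-negative fq<0 with compare 0# q
      ... | tri> _ _ q<0 = <⇒≱ q<0 (proj₁ q∈)
      ... | tri≈ _ 0≈q _ = <-asym fq<0 (near-0 (sym 0≈q) q∈ S)
      ... | tri< 0<q _ _ with Lipschitz-pos (Lipschitz-neg (lip S)) q∈
                                (<-by (<⇒0<- fq<0) (solve 1 (λ a → con (pos 0) :- a := :- a :- con (pos 0)) refl (f S q)))
      -- All points of the range within δ of q have negative values. The point tested is q - δ, or 0
      -- if q - δ is negative; both lie below q, where the values are positive.
      ...   | δ , 0<δ , near = impossible (0# ≤? q - δ)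
        where
        contra : ∀ {x} → 0# ≤ x → x < q → q - x ≤ δ → ⊥
        contra {x} 0≤x x<q q-x≤δ = <-asym (below-q 0≤x x<q S)
          (<-by (near (0≤x , ≤-trans (<⇒≤ x<q) (proj₂ q∈))
                  (≤-trans (≤-by (≤⇒0≤- (<⇒≤ x<q)) (solve 2 (λ x q → q :- x := con (pos 0) :- (x :- q)) refl x q)) (<⇒≤ 0<δ)) q-x≤δ)
             (solve 1 (λ a → :- a := con (pos 0) :- a) refl (f S x)))
        impossible : Dec (0# ≤ q - δ) → ⊥
        impossible (yes 0≤q-δ) = contra 0≤q-δ (<-by 0<δ (solve 2 (λ q δ → δ := q :- (q :- δ)) refl q δ))
          (≤-reflexive (solve 2 (λ q δ → q :- (q :- δ) := δ) refl q δ))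
        impossible (no 0≰q-δ) = contra ≤-refl 0<q (<⇒≤ (<-by (<⇒0<- (≰⇒> 0≰q-δ))
          (solve 2 (λ q δ → con (pos 0) :- (q :- δ) := δ :- (q :- con (pos 0))) refl q δ)))

    pos-q : ∀ S → 0# < f S q
    pos-q S = ≰⇒> λ fSq≤0 → f⊤≉0 q∈
      (antisym (≤-trans (f⊤-least q∈ nonneg-q S) fSq≤0) (nonneg-q ⊤))

    near-q : ∃[ δ ] 0# < δ × (∀ S → PositiveNear (f S) q δ)
    near-q = PositiveNear-uniform λ S → Lipschitz-pos (lip S) q∈ (pos-q S)
    ≤⇒-≤ : ∀ {x y d} → x ≤ y → 0# < d → x - y ≤ d
    ≤⇒-≤ {x} {y} x≤y 0<d = ≤-trans
      (≤-by (≤⇒0≤- x≤y) (solve 2 (λ x y → y :- x := con (pos 0) :- (x :- y)) refl x y)) (<⇒≤ 0<d)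

    positive : ∀ S → 0# < f S M
    positive S with near-q
    ... | δ , 0<δ , near = near S (0≤M , ≤-refl) (≤⇒-≤ M≤q 0<δ) (≤⇒-≤ (proj₂ q∈) 0<δ)
      where
      good : ∀ {r} → InRange r → r ≤ q + δ → Good r
      good {r} r∈@(_ , r≤M) r≤q+δ = r∈ , λ {x} 0≤x x≤r S → positive-below 0≤x x≤r S (x <? q)
        where
        positive-below : ∀ {x} → 0# ≤ x → x ≤ r → ∀ S → Dec (x < q) → 0# < f S x
        positive-below 0≤x x≤r S (yes x<q) = below-q 0≤x x<q S
        positive-below {x} 0≤x x≤r S (no x≮q) = near S (0≤x , ≤-trans x≤r r≤M)
          (≤-by (≤⇒0≤- (≤-trans x≤r r≤q+δ)) (solve 3 (λ q δ x → q :+ δ :- x := δ :- (x :- q)) refl q δ x))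
          (≤⇒-≤ (≮⇒≥ x≮q) 0<δ)
      q<q+δ : q < q + δ
      q<q+δ = <-by 0<δ (solve 2 (λ q δ → δ := q :+ δ :- q) refl q δ)
      M≤q : M ≤ q
      -- If q < M, then the minimum of q + δ and M is a good point beyond the supremum. So q = M,
      -- and the positivity near q applies to M.
      M≤q = ≮⇒≥ λ q<M → beyond q<M (∃-min (q + δ) M)
        where
        beyond : q < M → ∃[ r ] r ≤ q + δ × r ≤ M × (r ≡ q + δ ⊎ r ≡ M) → ⊥
        beyond q<M (r , r≤q+δ , r≤M , which) = <⇒≱ (q<r which)
          (proj₁ q-isSup (good (≤-trans (proj₁ q∈) (<⇒≤ (q<r which)) , r≤M) r≤q+δ))
          where
          q<r : r ≡ q + δ ⊎ r ≡ M → q < r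
          q<r (inj₁ ≡.refl) = q<q+δ
          q<r (inj₂ ≡.refl) = q<M

-- Möbius polynomials: recursion, monotonicity, positivity.

∈-∩∁⁺ : ∀ {n} {S T : Subset n} {a} → a ∈ S → a ∉ T → a ∈ S ∩ ∁ T
∈-∩∁⁺ a∈S a∉T = Subset.x∈p∩q⁺ (a∈S , Subset.x∉p⇒x∈∁p a∉T)

∈-∩∁⁻ : ∀ {n} (S T : Subset n) {a} → a ∈ S ∩ ∁ T → a ∈ S × a ∉ T
∈-∩∁⁻ S T a∈ with Subset.x∈p∩q⁻ S (∁ T) a∈
... | a∈S , a∈∁T = a∈S , Subset.x∈∁p⇒x∉p a∈∁T

∩∁⁅⁆-⊂ : ∀ {n} {S : Subset n} {a} → a ∈ S → S ∩ ∁ ⁅ a ⁆ ⊂ S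
∩∁⁅⁆-⊂ {S = S} {a} a∈S = Subset.p∩q⊆p S (∁ ⁅ a ⁆) ,
  a , a∈S , λ a∈ → proj₂ (∈-∩∁⁻ S ⁅ a ⁆ a∈) (Subset.x∈⁅x⁆ a)

module Möbius (ℝ : CompleteOrderedField) {n : ℕ} (R : Rel (Fin n) 0ℓ) (R? : Decidable R)
              (R-refl : Reflexive R) (R-sym : Symmetric R) where
  open CompleteOrderedField ℝ hiding (zero)
  open Reals ℝ
  open Traces R R?
  open TraceTheory R R? R-refl R-sym using (∈𝓛⇒R; R⇒∈𝓛)
  open Laws ℝ

  term : ∀ {m} → Carrier → Subset m → Carrier
  term X γ = (- 1#) ^ ∣ γ ∣ * X ^ ∣ γ ∣

  ∑ₛ : ∀ {m} → (Subset m → Carrier) → Carrier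
  ∑ₛ f = sumList (map f (allSubsets _))

  sumList-++ : ∀ xs ys → sumList (xs ++ ys) ≈ sumList xs + sumList ys
  sumList-++ []       ys = sym (+-identityˡ _)
  sumList-++ (x ∷ xs) ys = trans (+-congˡ (sumList-++ xs ys)) (sym (+-assoc _ _ _))

  sumList-cong : ∀ {A : Set} {f g : A → Carrier} → (∀ x → f x ≈ g x) → ∀ xs →
                 sumList (map f xs) ≈ sumList (map g xs)
  sumList-cong f≈g []       = refl
  sumList-cong f≈g (x ∷ xs) = +-cong (f≈g x) (sumList-cong f≈g xs)

  ∑ₛ-suc : ∀ {m} (f : Subset (suc m) → Carrier) →
           ∑ₛ f ≈ ∑ₛ (f ∘ (outside Vec.∷_)) + ∑ₛ (f ∘ (inside Vec.∷_))
  ∑ₛ-suc {m} f = begin-equality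
    sumList (map f (outs ++ ins))                ≡⟨ ≡.cong sumList (List.map-++ f outs ins) ⟩
    sumList (map f outs ++ map f ins)            ≈⟨ sumList-++ (map f outs) (map f ins) ⟩
    sumList (map f outs) + sumList (map f ins)   ≡⟨ ≡.cong₂ (λ xs ys → sumList xs + sumList ys)
                                                      (List.map-∘ (allSubsets m)) (List.map-∘ (allSubsets m)) ⟨
    ∑ₛ (f ∘ (outside Vec.∷_)) + ∑ₛ (f ∘ (inside Vec.∷_)) ∎
    where
    outs ins : List (Subset (suc m))
    outs = map (outside Vec.∷_) (allSubsets m)
    ins  = map (inside Vec.∷_) (allSubsets m)

  ∑ₛ-cong : ∀ {m} {f g : Subset m → Carrier} → (∀ γ → f γ ≈ g γ) → ∑ₛ f ≈ ∑ₛ g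
  ∑ₛ-cong f≈g = sumList-cong f≈g (allSubsets _)

  ∑ₛ-zero : ∀ {m} {f : Subset m → Carrier} → (∀ γ → f γ ≈ 0#) → ∑ₛ f ≈ 0#
  ∑ₛ-zero {m} f≈0 = go (allSubsets m)
    where
    go : ∀ γs → sumList (map _ γs) ≈ 0#
    go []       = refl
    go (γ ∷ γs) = trans (+-cong (f≈0 γ) (go γs)) (+-identityˡ 0#)

  ∑ₛ-sub : ∀ {m} (f g : Subset m → Carrier) X → ∑ₛ (λ γ → f γ - X * g γ) ≈ ∑ₛ f - X * ∑ₛ g
  ∑ₛ-sub {m} f g X = go (allSubsets m)
    where
    go : ∀ γs → sumList (map (λ γ → f γ - X * g γ) γs) ≈ sumList (map f γs) - X * sumList (map g γs)
    go []       = solve 1 (λ X → con (pos 0) := con (pos 0) :- X :* con (pos 0)) refl X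
    go (γ ∷ γs) = trans (+-congˡ (go γs))
      (solve 5 (λ X a b c d → a :- X :* b :+ (c :- X :* d) := a :+ c :- X :* (b :+ d)) refl X _ _ _ _)

  ∑ₛ-pivot : ∀ {m} (a : Fin m) (f : Subset m → Carrier) →
             ∑ₛ f ≈ ∑ₛ λ γ → if lookup γ a then 0# else f γ + f (γ [ a ]≔ inside)
  ∑ₛ-pivot {suc m} zero f = begin-equality
    ∑ₛ f                                               ≈⟨ ∑ₛ-suc f ⟩
    ∑ₛ (f ∘ (outside Vec.∷_)) + ∑ₛ (f ∘ (inside Vec.∷_)) ≈⟨ go (allSubsets m) ⟨
    ∑ₛ (g ∘ (outside Vec.∷_))                          ≈⟨ +-identityʳ _ ⟨
    ∑ₛ (g ∘ (outside Vec.∷_)) + 0#                     ≈⟨ +-congˡ (∑ₛ-zero {m} λ _ → refl) ⟨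
    ∑ₛ (g ∘ (outside Vec.∷_)) + ∑ₛ (g ∘ (inside Vec.∷_)) ≈⟨ ∑ₛ-suc g ⟨
    ∑ₛ g                                               ∎
    where
    g : Subset (suc m) → Carrier
    g γ = if lookup γ zero then 0# else f γ + f (γ [ zero ]≔ inside)
    go : ∀ γs → sumList (map (g ∘ (outside Vec.∷_)) γs) ≈
                sumList (map (f ∘ (outside Vec.∷_)) γs) + sumList (map (f ∘ (inside Vec.∷_)) γs)
    go []       = sym (+-identityˡ 0#)
    go (γ ∷ γs) = trans (+-congˡ (go γs))
      (solve 4 (λ a b c d → a :+ b :+ (c :+ d) := a :+ c :+ (b :+ d)) refl _ _ _ _)
  ∑ₛ-pivot {suc m} (suc a) f = trans (∑ₛ-suc f) (trans
    (+-cong (∑ₛ-pivot a (f ∘ (outside Vec.∷_))) (∑ₛ-pivot a (f ∘ (inside Vec.∷_))))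
    (sym (∑ₛ-suc λ γ → if lookup γ (suc a) then 0# else f γ + f (γ [ suc a ]≔ inside))))

  -- Iverson bracket. It turns the sum over the cliques of S into a sum over all subsets, so that
  -- sums for different alphabets can be compared term by term.
  [_]*_ : ∀ {P : Set} → Dec P → Carrier → Carrier
  [ P? ]* x = if does P? then x else 0#

  sumList-filter : ∀ {A : Set} {P : Pred A 0ℓ} (P? : U.Decidable P) (f : A → Carrier) xs →
                   sumList (map f (filter P? xs)) ≈ sumList (map (λ x → [ P? x ]* f x) xs)
  sumList-filter P? f [] = refl
  sumList-filter P? f (x ∷ xs) with does (P? x)
  ... | true  = +-congˡ (sumList-filter P? f xs)
  ... | false = trans (sumList-filter P? f xs) (sym (+-identityˡ _))

  cliqueTerm : Subset n → Carrier → Subset n → Carrier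
  cliqueTerm S X γ = [ isClique? S γ ]* term X γ

  μ≈∑ₛ : ∀ S X → μ S X ≈ ∑ₛ (cliqueTerm S X)
  μ≈∑ₛ S X = sumList-filter (isClique? S) (term X) (allSubsets n)

  []*-no : ∀ {P : Set} (P? : Dec P) {x} → ¬ P → [ P? ]* x ≈ 0#
  []*-no P? {x} ¬p rewrite dec-false P? ¬p = refl

  []*-yes : ∀ {P : Set} (P? : Dec P) {x} → P → [ P? ]* x ≈ x
  []*-yes P? {x} p rewrite dec-true P? p = refl

  []*-⇔ : ∀ {P Q : Set} (P? : Dec P) (Q? : Dec Q) {x} → (P → Q) → (Q → P) → [ P? ]* x ≈ [ Q? ]* x
  []*-⇔ P? Q? {x} P→Q Q→P with Q?
  ... | yes q = []*-yes P? (Q→P q)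
  ... | no ¬q = []*-no P? (¬q ∘ P→Q)

  ∣[]≔inside∣ : ∀ {m} (γ : Subset m) a → lookup γ a ≡ outside → ∣ γ [ a ]≔ inside ∣ ≡ suc ∣ γ ∣
  ∣[]≔inside∣ (outside Vec.∷ γ) zero    _ = ≡.refl
  ∣[]≔inside∣ (outside Vec.∷ γ) (suc a) a∉γ = ∣[]≔inside∣ γ a a∉γ
  ∣[]≔inside∣ (inside  Vec.∷ γ) (suc a) a∉γ = ≡.cong suc (∣[]≔inside∣ γ a a∉γ)

  ∈-[]≔⁻ : ∀ {m} (γ : Subset m) a {b} → b ∈ γ [ a ]≔ inside → b ≢ a → b ∈ γ
  ∈-[]≔⁻ γ a {b} b∈ b≢a = Vec.lookup⇒[]= b γ
    (≡.trans (≡.sym (Vec.lookup∘update′ b≢a γ inside)) (Vec.[]=⇒lookup b∈))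

  ∈-[]≔⁺ : ∀ {m} (γ : Subset m) a {b} → b ≢ a → b ∈ γ → b ∈ γ [ a ]≔ inside
  ∈-[]≔⁺ γ a {b} b≢a = Vec.[]≔-minimal γ b a b≢a

  module _ {S : Subset n} {a : Fin n} (a∈S : a ∈ S) {γ : Subset n} (a∉γ : a ∉ γ) where

    IsClique-∌ : IsClique S γ → IsClique (S ∩ ∁ ⁅ a ⁆) γ
    IsClique-∌ (γ⊆S , clique) = (λ {b} b∈γ → ∈-∩∁⁺ (γ⊆S b∈γ)
      λ b∈⁅a⁆ → a∉γ (≡.subst (_∈ γ) (Subset.x∈⁅y⁆⇒x≡y a b∈⁅a⁆) b∈γ)) , clique

    IsClique-∋⁻ : IsClique S (γ [ a ]≔ inside) → IsClique (S ∩ ∁ (𝓛 a)) γ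
    IsClique-∋⁻ (γa⊆S , clique) =
      (λ {b} b∈γ → ∈-∩∁⁺ (γa⊆S (lift b∈γ)) λ b∈𝓛 →
        clique a b (Vec.[]≔-updates γ a) (lift b∈γ) (a≢ b∈γ) (∈𝓛⇒R b∈𝓛)) ,
      λ b c b∈γ c∈γ → clique b c (lift b∈γ) (lift c∈γ)
      where
      a≢ : ∀ {b} → b ∈ γ → a ≢ b
      a≢ b∈γ ≡.refl = a∉γ b∈γ
      lift : ∀ {b} → b ∈ γ → b ∈ γ [ a ]≔ inside
      lift b∈γ = ∈-[]≔⁺ γ a (a≢ b∈γ ∘ ≡.sym) b∈γ

    IsClique-∋⁺ : IsClique (S ∩ ∁ (𝓛 a)) γ → IsClique S (γ [ a ]≔ inside)
    IsClique-∋⁺ (γ⊆ , clique) = (λ {b} → ⊆S b) , clique′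
      where
      unrelated : ∀ {b} → b ∈ γ → ¬ R a b
      unrelated b∈γ r = proj₂ (∈-∩∁⁻ S (𝓛 a) (γ⊆ b∈γ)) (R⇒∈𝓛 r)
      ⊆S : ∀ b → b ∈ γ [ a ]≔ inside → b ∈ S
      ⊆S b b∈ with b Fin.≟ a
      ... | yes ≡.refl = a∈S
      ... | no b≢a     = proj₁ (∈-∩∁⁻ S (𝓛 a) (γ⊆ (∈-[]≔⁻ γ a b∈ b≢a)))
      clique′ : ∀ b c → b ∈ γ [ a ]≔ inside → c ∈ γ [ a ]≔ inside → b ≢ c → ¬ R b c
      clique′ b c b∈ c∈ b≢c with b Fin.≟ a | c Fin.≟ a
      ... | yes ≡.refl | yes ≡.refl = ⊥-elim (b≢c ≡.refl)
      ... | yes ≡.refl | no c≢a     = unrelated (∈-[]≔⁻ γ a c∈ c≢a)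
      ... | no b≢a     | yes ≡.refl = unrelated (∈-[]≔⁻ γ a b∈ b≢a) ∘ R-sym
      ... | no b≢a     | no c≢a     = clique b c (∈-[]≔⁻ γ a b∈ b≢a) (∈-[]≔⁻ γ a c∈ c≢a) b≢c

  -- The cliques of S avoiding a are the cliques of S without a. Those containing a arise by adding
  -- a to a clique of letters of S unrelated to a, and the added letter contributes the factor -X.
  μ-recursion : ∀ {S a} X → a ∈ S → μ S X ≈ μ (S ∩ ∁ ⁅ a ⁆) X - X * μ (S ∩ ∁ (𝓛 a)) X
  μ-recursion {S} {a} X a∈S = begin-equality
    μ S X                                   ≈⟨ μ≈∑ₛ S X ⟩
    ∑ₛ (cliqueTerm S X)                     ≈⟨ ∑ₛ-pivot a (cliqueTerm S X) ⟩
    ∑ₛ (λ γ → if lookup γ a then 0# else cliqueTerm S X γ + cliqueTerm S X (γ [ a ]≔ inside))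
                                            ≈⟨ ∑ₛ-cong termwise ⟩
    ∑ₛ (λ γ → cliqueTerm (S ∩ ∁ ⁅ a ⁆) X γ - X * cliqueTerm (S ∩ ∁ (𝓛 a)) X γ)
                                            ≈⟨ ∑ₛ-sub (cliqueTerm (S ∩ ∁ ⁅ a ⁆) X) (cliqueTerm (S ∩ ∁ (𝓛 a)) X) X ⟩
    ∑ₛ (cliqueTerm (S ∩ ∁ ⁅ a ⁆) X) - X * ∑ₛ (cliqueTerm (S ∩ ∁ (𝓛 a)) X)
                                            ≈⟨ +-cong (μ≈∑ₛ (S ∩ ∁ ⁅ a ⁆) X)
                                                 (-‿cong (*-congˡ (μ≈∑ₛ (S ∩ ∁ (𝓛 a)) X))) ⟨
    μ (S ∩ ∁ ⁅ a ⁆) X - X * μ (S ∩ ∁ (𝓛 a)) X ∎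
    where
    termwise : ∀ γ → (if lookup γ a then 0# else cliqueTerm S X γ + cliqueTerm S X (γ [ a ]≔ inside)) ≈
                     cliqueTerm (S ∩ ∁ ⁅ a ⁆) X γ - X * cliqueTerm (S ∩ ∁ (𝓛 a)) X γ
    termwise γ with lookup γ a in eq
    -- The pairing leaves 0 for γ containing a. The clique terms on the right vanish too: a lies in
    -- neither of the two alphabets, for the second one because a ∈ `𝓛 a`.
    ... | true = sym (begin-equality
      cliqueTerm (S ∩ ∁ ⁅ a ⁆) X γ - X * cliqueTerm (S ∩ ∁ (𝓛 a)) X γ
        ≈⟨ +-cong ([]*-no (isClique? (S ∩ ∁ ⁅ a ⁆) γ) λ (γ⊆ , _) → proj₂ (∈-∩∁⁻ S ⁅ a ⁆ (γ⊆ a∈γ)) (Subset.x∈⁅x⁆ a))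
             (-‿cong (*-congˡ ([]*-no (isClique? (S ∩ ∁ (𝓛 a)) γ) λ (γ⊆ , _) → proj₂ (∈-∩∁⁻ S (𝓛 a) (γ⊆ a∈γ)) (R⇒∈𝓛 R-refl)))) ⟩
      0# - X * 0#  ≈⟨ solve 1 (λ X → con (pos 0) :- X :* con (pos 0) := con (pos 0)) refl X ⟩
      0#           ∎)
      where
      a∈γ : a ∈ γ
      a∈γ = Vec.lookup⇒[]= a γ eq
    ... | false = +-cong
      ([]*-⇔ (isClique? S γ) (isClique? (S ∩ ∁ ⁅ a ⁆) γ) (IsClique-∌ a∈S a∉γ)
        λ (γ⊆ , clique) → (λ b∈γ → proj₁ (∈-∩∁⁻ S ⁅ a ⁆ (γ⊆ b∈γ))) , clique)
      (begin-equality
        cliqueTerm S X (γ [ a ]≔ inside)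
          ≈⟨ []*-⇔ (isClique? S (γ [ a ]≔ inside)) (isClique? (S ∩ ∁ (𝓛 a)) γ)
               (IsClique-∋⁻ a∈S a∉γ) (IsClique-∋⁺ a∈S a∉γ) ⟩
        ([ isClique? (S ∩ ∁ (𝓛 a)) γ ]* term X (γ [ a ]≔ inside))
          ≈⟨ factor (does (isClique? (S ∩ ∁ (𝓛 a)) γ)) ⟩
        - (X * cliqueTerm (S ∩ ∁ (𝓛 a)) X γ) ∎)
      where
      a∉γ : a ∉ γ
      a∉γ a∈γ with () ← ≡.trans (≡.sym eq) (Vec.[]=⇒lookup a∈γ)
      factor : ∀ b → (if b then term X (γ [ a ]≔ inside) else 0#) ≈ - (X * (if b then term X γ else 0#))
      factor false = solve 1 (λ X → con (pos 0) := :- (X :* con (pos 0))) refl X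
      factor true rewrite ∣[]≔inside∣ γ a eq = solve 3
        (λ X s t → (:- con (pos 1) :* s) :* (X :* t) := :- (X :* (s :* t))) refl X ((- 1#) ^ ∣ γ ∣) (X ^ ∣ γ ∣)

  ∑ₛ-only-⊥ : ∀ {m} {f : Subset m → Carrier} → (∀ γ {k} → ∣ γ ∣ ≡ suc k → f γ ≈ 0#) → ∑ₛ f ≈ f Subset.⊥
  ∑ₛ-only-⊥ {ℕ.zero} f≈0 = +-identityʳ _
  ∑ₛ-only-⊥ {suc m} {f} f≈0 = begin-equality
    ∑ₛ f                                                 ≈⟨ ∑ₛ-suc f ⟩
    ∑ₛ (f ∘ (outside Vec.∷_)) + ∑ₛ (f ∘ (inside Vec.∷_)) ≈⟨ +-cong (∑ₛ-only-⊥ λ γ → f≈0 (outside Vec.∷ γ))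
                                                              (∑ₛ-zero λ γ → f≈0 (inside Vec.∷ γ) ≡.refl) ⟩
    f Subset.⊥ + 0#                                      ≈⟨ +-identityʳ _ ⟩
    f Subset.⊥                                           ∎

  μ-0 : ∀ S → μ S 0# ≈ 1#
  μ-0 S = begin-equality
    μ S 0#                     ≈⟨ μ≈∑ₛ S 0# ⟩
    ∑ₛ (cliqueTerm S 0#)       ≈⟨ ∑ₛ-only-⊥ vanishes ⟩
    cliqueTerm S 0# Subset.⊥   ≈⟨ []*-yes (isClique? S Subset.⊥) ((λ b∈ → ⊥-elim (Subset.∉⊥ b∈)) ,
                                    λ _ _ b∈ → ⊥-elim (Subset.∉⊥ b∈)) ⟩
    term 0# (Subset.⊥ {n})     ≡⟨ ≡.cong (λ k → (- 1#) ^ k * 0# ^ k) (Subset.∣⊥∣≡0 n) ⟩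
    1# * 1#                    ≈⟨ *-identityˡ 1# ⟩
    1#                         ∎
    where
    vanishes : ∀ γ {k} → ∣ γ ∣ ≡ suc k → cliqueTerm S 0# γ ≈ 0#
    vanishes γ {k} eq with does (isClique? S γ)
    ... | false = refl
    ... | true rewrite eq = trans (*-congˡ (zeroˡ _)) (zeroʳ _)

  -- Removing a from T raises the value by q μ of T without 𝓛(a), which is nonnegative. The
  -- induction compares T with T ∩ S, so that the letters outside S can be removed one at a time;
  -- the claim is the case T = ⊤.
  μ-least : ∀ {q} → 0# ≤ q → (∀ S → 0# ≤ μ S q) → ∀ S → μ ⊤ q ≤ μ S q
  μ-least {q} 0≤q 0≤μ S = ≤-trans (go ⊤) (≤-reflexive (reflexive (≡.cong (λ T → μ T q) (Subset.∩-identityˡ S))))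
    where
    step : ∀ T → (∀ {T′} → T′ ⊂ T → μ T′ q ≤ μ (T′ ∩ S) q) → μ T q ≤ μ (T ∩ S) q
    step T rec with Fin.any? (λ a → (a Subset.∈? T) ×-dec ¬? (a Subset.∈? S))
    ... | yes (a , a∈T , a∉S) = begin
      μ T q                       ≤⟨ ≤-by (*-nonneg 0≤q (0≤μ (T ∩ ∁ (𝓛 a)))) (begin-equality
        q * μ (T ∩ ∁ (𝓛 a)) q       ≈⟨ solve 2 (λ x y → y := x :- (x :- y)) refl (μ (T ∩ ∁ ⁅ a ⁆) q) _ ⟩
        μ (T ∩ ∁ ⁅ a ⁆) q - (μ (T ∩ ∁ ⁅ a ⁆) q - q * μ (T ∩ ∁ (𝓛 a)) q)
                                    ≈⟨ +-congˡ (-‿cong (μ-recursion q a∈T)) ⟨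
        μ (T ∩ ∁ ⁅ a ⁆) q - μ T q   ∎) ⟩
      μ (T ∩ ∁ ⁅ a ⁆) q           ≤⟨ rec (∩∁⁅⁆-⊂ a∈T) ⟩
      μ ((T ∩ ∁ ⁅ a ⁆) ∩ S) q     ≡⟨ ≡.cong (λ T → μ T q) (Subset.⊆-antisym ⊆₁ ⊆₂) ⟩
      μ (T ∩ S) q                 ∎
      where
      ⊆₁ : (T ∩ ∁ ⁅ a ⁆) ∩ S ⊆ T ∩ S
      ⊆₁ b∈ with Subset.x∈p∩q⁻ (T ∩ ∁ ⁅ a ⁆) S b∈
      ... | b∈T , b∈S = Subset.x∈p∩q⁺ (proj₁ (∈-∩∁⁻ T ⁅ a ⁆ b∈T) , b∈S)
      ⊆₂ : T ∩ S ⊆ (T ∩ ∁ ⁅ a ⁆) ∩ S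
      ⊆₂ b∈ with Subset.x∈p∩q⁻ T S b∈
      ... | b∈T , b∈S = Subset.x∈p∩q⁺ (∈-∩∁⁺ b∈T (λ b∈⁅a⁆ →
              a∉S (≡.subst (_∈ S) (Subset.x∈⁅y⁆⇒x≡y a b∈⁅a⁆) b∈S)) , b∈S)
    ... | no T⊆S = ≤-reflexive (reflexive (≡.cong (λ T → μ T q)
                     (Subset.⊆-antisym (λ {b} b∈T → Subset.x∈p∩q⁺ (b∈T , T⊆S′ b b∈T)) (Subset.p∩q⊆p T S))))
      where
      T⊆S′ : ∀ b → b ∈ T → b ∈ S
      T⊆S′ b b∈T with b Subset.∈? S
      ... | yes b∈S = b∈S
      ... | no b∉S  = ⊥-elim (T⊆S (b , b∈T , b∉S))
    go : ∀ T → μ T q ≤ μ (T ∩ S) q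
    go = WellFounded.All.wfRec ⊂-wellFounded 0ℓ (λ T → μ T q ≤ μ (T ∩ S) q) step

  module _ {M : Carrier} (0≤M : 0# ≤ M) where
    open Lipschitz ℝ M 0≤M

    -- Each term is -X times the preceding one, so stability under negation and under multiplication
    -- by X suffices.
    term-lipschitz : ∀ k → IsLipschitz λ X → (- 1#) ^ k * X ^ k
    term-lipschitz ℕ.zero = Lipschitz-cong (λ _ → sym (*-identityˡ 1#)) (Lipschitz-const 0≤1)
    term-lipschitz (suc k) = Lipschitz-cong
      (λ X → solve 3 (λ X s t → :- (X :* (s :* t)) := (:- con (pos 1) :* s) :* (X :* t)) refl X ((- 1#) ^ k) (X ^ k))
      (Lipschitz-neg (Lipschitz-id* (term-lipschitz k)))

    μ-lipschitz : ∀ S → IsLipschitz (μ S)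
    μ-lipschitz S = go (filter (isClique? S) (allSubsets n))
      where
      go : ∀ γs → IsLipschitz λ X → sumList (map (term X) γs)
      go []       = Lipschitz-const ≤-refl
      go (γ ∷ γs) = Lipschitz-+ (term-lipschitz ∣ γ ∣) (go γs)

    μ-pos : (∀ {q} → InRange q → μ ⊤ q ≉ 0#) → ∀ S → 0# < μ S M
    μ-pos = PositiveFamily.positive μ μ-lipschitz
      (λ S → <-respʳ-≈ (sym (μ-0 S)) 0<1) (λ (0≤q , _) → μ-least 0≤q)

  open RawRing ℂ using () renaming (_≈_ to _≈ᶜ_; _+_ to _+ᶜ_; _*_ to _*ᶜ_; -_ to -ᶜ_; 1# to 1ᶜ)
  open RawSemiringDefs (RawRing.rawSemiring ℂ) using () renaming (_^_ to _^ᶜ_)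

  -- `ℂ` comes with operations only, not with ring laws; the evaluation of the polynomial at a real
  -- point is therefore followed componentwise.
  *-embed : ∀ {z w x y} → z ≈ᶜ (x , 0#) → w ≈ᶜ (y , 0#) → (z *ᶜ w) ≈ᶜ (x * y , 0#)
  *-embed {x = x} {y} (a≈x , b≈0) (c≈y , d≈0) =
    trans (+-cong (*-cong a≈x c≈y) (-‿cong (*-cong b≈0 d≈0)))
      (solve 2 (λ x y → x :* y :- con (pos 0) :* con (pos 0) := x :* y) refl x y) ,
    trans (+-cong (*-cong a≈x d≈0) (*-cong b≈0 c≈y))
      (solve 2 (λ x y → x :* con (pos 0) :+ con (pos 0) :* y := con (pos 0)) refl x y)

  ^-embed : ∀ {z x} → z ≈ᶜ (x , 0#) → ∀ k → (z ^ᶜ k) ≈ᶜ (x ^ k , 0#)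
  ^-embed z≈x ℕ.zero  = refl , refl
  ^-embed z≈x (suc k) = *-embed z≈x (^-embed z≈x k)

  μ-embed : ∀ S q → μ[ ℂ ] S (q , 0#) ≈ᶜ (μ S q , 0#)
  μ-embed S q = go (filter (isClique? S) (allSubsets n))
    where
    -0≈0 : - 0# ≈ 0#
    -0≈0 = solve 0 (:- con (pos 0) := con (pos 0)) refl
    go : ∀ γs → foldr _+ᶜ_ (0# , 0#) (map (λ γ → ((-ᶜ 1ᶜ) ^ᶜ ∣ γ ∣) *ᶜ ((q , 0#) ^ᶜ ∣ γ ∣)) γs) ≈ᶜ
                (sumList (map (term q) γs) , 0#)
    go []       = refl , refl
    go (γ ∷ γs) with *-embed (^-embed {z = -ᶜ 1ᶜ} (refl , -0≈0) ∣ γ ∣) (^-embed {z = q , 0#} (refl , refl) ∣ γ ∣) | go γs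
    ... | re , im | re′ , im′ = +-cong re re′ , trans (+-cong im im′) (+-identityˡ 0#)

  -- A root q of μ_Σ in [0, p] would be a complex root different from `pΣ` whose modulus does not
  -- exceed that of `pΣ`.
  μ-pos-below-root : ∀ {p pΣ} → IsSmallestRoot ⊤ pΣ → 0# < p → p < pΣ → ∀ S → 0# < μ S p
  μ-pos-below-root {p} {pΣ} (_ , smallest) 0<p p<pΣ = μ-pos (<⇒≤ 0<p) no-root
    where
    no-root : ∀ {q} → 0# ≤ q × q ≤ p → μ ⊤ q ≉ 0#
    no-root {q} (0≤q , q≤p) μ≈0 = <⇒≱ (smallest (q , 0#) root λ (q≈pΣ , _) → <⇒≱ q<pΣ (≤-reflexive (sym q≈pΣ))) (begin
      q * q + 0# * 0#     ≤⟨ +-mono-≤ (≤-trans (*-monoˡ-≤ 0≤q (<⇒≤ q<pΣ)) (*-monoʳ-≤ (<⇒≤ (<-trans 0<p p<pΣ)) (<⇒≤ q<pΣ))) ≤-refl ⟩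
      pΣ * pΣ + 0# * 0#   ∎)
      where
      q<pΣ : q < pΣ
      q<pΣ = ≰⇒> λ pΣ≤q → <⇒≱ p<pΣ (≤-trans pΣ≤q q≤p)
      root : μ[ ℂ ] ⊤ (q , 0#) ≈ᶜ (0# , 0#)
      root = trans (proj₁ (μ-embed ⊤ q)) μ≈0 , proj₂ (μ-embed ⊤ q)

-- The weight of the traces with prescribed maximal letters.

∩∁-absorb : ∀ {n} {S T : Subset n} {a} → a ∈ T → (S ∩ ∁ ⁅ a ⁆) ∩ ∁ T ≡ S ∩ ∁ T
∩∁-absorb {S = S} {T} {a} a∈T = Subset.⊆-antisym ⊆₁ ⊆₂
  where
  ⊆₁ : (S ∩ ∁ ⁅ a ⁆) ∩ ∁ T ⊆ S ∩ ∁ T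
  ⊆₁ b∈ with ∈-∩∁⁻ (S ∩ ∁ ⁅ a ⁆) T b∈
  ... | b∈S′ , b∉T = ∈-∩∁⁺ (proj₁ (∈-∩∁⁻ S ⁅ a ⁆ b∈S′)) b∉T
  ⊆₂ : S ∩ ∁ T ⊆ (S ∩ ∁ ⁅ a ⁆) ∩ ∁ T
  ⊆₂ b∈ with ∈-∩∁⁻ S T b∈
  ... | b∈S , b∉T = ∈-∩∁⁺ (∈-∩∁⁺ b∈S λ b∈⁅a⁆ →
          b∉T (≡.subst (_∈ T) (≡.sym (Subset.x∈⁅y⁆⇒x≡y a b∈⁅a⁆)) a∈T)) b∉T

module PyramidWeights (ℝ : CompleteOrderedField)
    {n : ℕ} (R : Rel (Fin n) 0ℓ) (R? : Decidable R) (R-refl : Reflexive R) (R-sym : Symmetric R)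
    (p : CompleteOrderedField.Carrier ℝ)
    (0<p : CompleteOrderedField._<_ ℝ (CompleteOrderedField.0# ℝ) p)
    (μ-pos : ∀ S → CompleteOrderedField._<_ ℝ (CompleteOrderedField.0# ℝ) (Traces.Laws.μ R R? ℝ S p)) where
  open CompleteOrderedField ℝ hiding (zero)
  open Reals ℝ
  open Traces R R?
  open Laws ℝ
  open TraceTheory R R? R-refl R-sym
  open Weights ℝ R R? R-refl R-sym p 0<p
  open Möbius ℝ R R? R-refl R-sym using (μ-recursion)

  μ-≉0 : ∀ S → μ S p ≉ 0#
  μ-≉0 S = >⇒≉ (μ-pos S)

  module _ {S : Subset n} {a : Fin n} (a∈S : a ∈ S) where

    -- The weight of the pyramids of apex a over S, as `HasWeight-PyrIn` shows; for S = ⊤ it is the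
    -- number r of the theorem.
    pyramidRate : Carrier
    pyramidRate = p * (μ (S ∩ ∁ (𝓛 a)) p / μ (S ∩ ∁ ⁅ a ⁆) p)

    pyramidRate≈ : pyramidRate ≈ 1# - μ S p / μ (S ∩ ∁ ⁅ a ⁆) p
    pyramidRate≈ = *-cancelʳ (μ-≉0 (S ∩ ∁ ⁅ a ⁆)) (begin-equality
      p * (m₁ / m) * m          ≈⟨ *-assoc p _ m ⟩
      p * (m₁ / m * m)          ≈⟨ *-congˡ (/-* (μ-≉0 (S ∩ ∁ ⁅ a ⁆))) ⟩
      p * m₁                    ≈⟨ solve 2 (λ x m → x := m :- (m :- x)) refl (p * m₁) m ⟩
      m - (m - p * m₁)          ≈⟨ +-congˡ (-‿cong (μ-recursion p a∈S)) ⟨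
      m - μ S p                 ≈⟨ +-congˡ (-‿cong (/-* (μ-≉0 (S ∩ ∁ ⁅ a ⁆)))) ⟨
      m - μ S p / m * m         ≈⟨ solve 2 (λ m x → m :- x :* m := (con (pos 1) :- x) :* m) refl m (μ S p / m) ⟩
      (1# - μ S p / m) * m      ∎)
      where
      m m₁ : Carrier
      m  = μ (S ∩ ∁ ⁅ a ⁆) p
      m₁ = μ (S ∩ ∁ (𝓛 a)) p

    1-pyramidRate : 1# - pyramidRate ≈ μ S p / μ (S ∩ ∁ ⁅ a ⁆) p
    1-pyramidRate = trans (+-congˡ (-‿cong pyramidRate≈))
      (solve 1 (λ x → con (pos 1) :- (con (pos 1) :- x) := x) refl _)

    -- Since 1 - r is a quotient of two values of Möbius polynomials, their positivity is what makes
    -- the geometric series of pyramids converge.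
    pyramidRate<1 : pyramidRate < 1#
    pyramidRate<1 = <-by (/-pos (μ-pos S) (μ-pos (S ∩ ∁ ⁅ a ⁆))) (sym 1-pyramidRate)

    PyrIn⊆Pyr : ∀ {x} → PyrIn (S ∩ ∁ ⁅ a ⁆) a x → Pyr a x
    PyrIn⊆Pyr = PyrIn-mono (Subset.p∩q⊆q S (∁ ⁅ a ⁆))

    PyrIn⊆𝓜 : ∀ {x} → PyrIn (S ∩ ∁ ⁅ a ⁆) a x → 𝓜 S x
    PyrIn⊆𝓜 (z , z∈ , _ , x≋za) = 𝓜-resp (≋-sym x≋za)
      (All⇒𝓜 (All.++⁺ (𝓜⇒All (𝓜-mono (Subset.p∩q⊆p S (∁ ⁅ a ⁆)) z∈)) (a∈S ∷ [])))

    -- The grading is the number of a's, which a pyramid raises by one. Because a ∈ T, a pyramid may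
    -- be put in front of any trace of the set, also of the empty one, without leaving the set.
    HasWeight-pyramids : ∀ {T r z} → a ∈ T →
      HasWeight (PyrIn (S ∩ ∁ ⁅ a ⁆) a) r → r < 1# →
      HasWeight (𝓜 (S ∩ ∁ ⁅ a ⁆) U.∩ Max⊆ T) z → HasWeight (𝓜 S U.∩ Max⊆ T) (z / (1# - r))
    HasWeight-pyramids {T} a∈T U≈r r<1 X₀≈z = HasWeight-geometric (count a) ≋-count
      (λ {u} pu → ≡.trans (count-++ a u) (≡.cong (ℕ._+ _) (Pyr-count (PyrIn⊆Pyr pu))))
      (split , λ { (inj₁ (x∈S′ , x⊆T)) → 𝓜-mono (Subset.p∩q⊆p S (∁ ⁅ a ⁆)) x∈S′ , x⊆T
                 ; (inj₂ (u , y , pu , (y∈S , y⊆T) , x≋uy)) →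
                     𝓜-resp (≋-sym x≋uy) (𝓜-++⁺ (PyrIn⊆𝓜 pu) y∈S) ,
                     Max⊆-resp (≋-sym x≋uy) (Pyr-++-Max⊆ a∈T pu y⊆T) })
      (λ (x∈S′ , _) → 𝓜-∁-count (𝓜-mono (Subset.p∩q⊆q S (∁ ⁅ a ⁆)) x∈S′))
      (λ pu pv → Pyr-++-injectiveˡ (PyrIn⊆Pyr pu) (PyrIn⊆Pyr pv))
      r<1 X₀≈z U≈r
      where
      split : (𝓜 S U.∩ Max⊆ T) U.⊆
              ((𝓜 (S ∩ ∁ ⁅ a ⁆) U.∩ Max⊆ T) U.∪ (PyrIn (S ∩ ∁ ⁅ a ⁆) a · (𝓜 S U.∩ Max⊆ T)))
      split {x} (x∈S , x⊆T) with Pyr-split a x x∈S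
      ... | inj₁ x∈S′ = inj₁ (x∈S′ , x⊆T)
      ... | inj₂ (u , y , pu , y∈S , x≋uy) =
              inj₂ (u , y , pu , (y∈S , Max⊆-++ʳ⁻ u (Max⊆-resp x≋uy x⊆T)) , x≋uy)

  pyramidRate-⊤ : ∀ a → pyramidRate {⊤} {a} Subset.∈⊤ ≡ p * (μ (∁ (𝓛 a)) p / μ (∁ ⁅ a ⁆) p)
  pyramidRate-⊤ a = ≡.cong₂ (λ S S′ → p * (μ S p / μ S′ p)) (Subset.∩-identityˡ _) (Subset.∩-identityˡ _)

  HasWeight-·[_] : ∀ {A s} a → HasWeight A s → HasWeight (A · (_≋ [ a ])) (s * weight [ a ])
  HasWeight-·[ a ] A≈s = HasWeight-·
    (λ _ _ y≋a y′≋a eq → ≋-cancelʳ [ a ] (≋-trans (≋-cong ≋-refl (≋-sym y≋a)) (≋-trans eq (≋-cong ≋-refl y′≋a))))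
    A≈s (HasWeight-singleton [ a ])

  PyrIn-≐ : ∀ {S a} → (𝓜 S U.∩ Max⊆ (𝓛 a)) · (_≋ [ a ]) ≐ PyrIn S a
  PyrIn-≐ = (λ (z , y , (z∈S , z⊆𝓛) , y≋a , x≋zy) → z , z∈S , z⊆𝓛 , ≋-trans x≋zy (≋-cong ≋-refl y≋a)) ,
            (λ (z , z∈S , z⊆𝓛 , x≋za) → z , _ , (z∈S , z⊆𝓛) , ≋-refl , x≋za)

  weight-[_] : ∀ a → weight [ a ] ≈ p
  weight-[ a ] = *-identityʳ p

  -- The apex contributes p, and the rest is a trace with maximal letters in 𝓛(a). Its weight is a
  -- hypothesis, so that the lemma applies inside the induction of `HasWeight-𝓜` as well as after
  -- it.
  HasWeight-PyrIn : ∀ {S a} → HasWeight (𝓜 (S ∩ ∁ ⁅ a ⁆) U.∩ Max⊆ (𝓛 a)) (μ ((S ∩ ∁ ⁅ a ⁆) ∩ ∁ (𝓛 a)) p / μ (S ∩ ∁ ⁅ a ⁆) p) →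
                    (a∈S : a ∈ S) → HasWeight (PyrIn (S ∩ ∁ ⁅ a ⁆) a) (pyramidRate a∈S)
  HasWeight-PyrIn {S} {a} Z a∈S = IsSup-resp-≈ (trans (*-comm _ _) (*-cong weight-[ a ]
      (*-congʳ (reflexive (≡.cong (λ T → μ T p) (∩∁-absorb {S = S} (R⇒∈𝓛 R-refl)))))))
    (HasWeight-≐ PyrIn-≐ (HasWeight-·[ a ] Z))

  -- T is quantified inside the induction on S, because the hypothesis for S without a is used
  -- twice: with `𝓛 a` for the pyramids and with T for the last factor. If S and T are disjoint,
  -- only the empty trace remains, and S ∩ ∁ T = S gives the value 1.
  HasWeight-𝓜 : ∀ S T → HasWeight (𝓜 S U.∩ Max⊆ T) (μ (S ∩ ∁ T) p / μ S p)
  HasWeight-𝓜 = WellFounded.All.wfRec ⊂-wellFounded 0ℓ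
    (λ S → ∀ T → HasWeight (𝓜 S U.∩ Max⊆ T) (μ (S ∩ ∁ T) p / μ S p)) step
    where
    step : ∀ S → (∀ {S′} → S′ ⊂ S → ∀ T → HasWeight (𝓜 S′ U.∩ Max⊆ T) (μ (S′ ∩ ∁ T) p / μ S′ p)) →
           ∀ T → HasWeight (𝓜 S U.∩ Max⊆ T) (μ (S ∩ ∁ T) p / μ S p)
    step S rec T with Fin.any? (λ a → (a Subset.∈? S) ×-dec (a Subset.∈? T))
    ... | yes (a , a∈S , a∈T) = IsSup-resp-≈ value
      (HasWeight-pyramids a∈S a∈T (HasWeight-PyrIn (rec (∩∁⁅⁆-⊂ a∈S) (𝓛 a)) a∈S) (pyramidRate<1 a∈S)
        (rec (∩∁⁅⁆-⊂ a∈S) T))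
      where
      S′ : Subset n
      S′ = S ∩ ∁ ⁅ a ⁆
      value : μ (S′ ∩ ∁ T) p / μ S′ p / (1# - pyramidRate a∈S) ≈ μ (S ∩ ∁ T) p / μ S p
      value = /-unique (>⇒≉ (<⇒0<- (pyramidRate<1 a∈S))) (begin-equality
        μ (S′ ∩ ∁ T) p / μ S′ p     ≡⟨ ≡.cong (λ T → μ T p / μ S′ p) (∩∁-absorb {S = S} a∈T) ⟩
        μ (S ∩ ∁ T) p / μ S′ p      ≈⟨ *-congʳ (/-* (μ-≉0 S)) ⟨
        μ (S ∩ ∁ T) p / μ S p * μ S p / μ S′ p   ≈⟨ *-assoc _ _ _ ⟩
        μ (S ∩ ∁ T) p / μ S p * (μ S p / μ S′ p) ≈⟨ *-congˡ (1-pyramidRate a∈S) ⟨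
        μ (S ∩ ∁ T) p / μ S p * (1# - pyramidRate a∈S) ∎)
    ... | no S∩T=∅ = IsSup-resp-≈ value (HasWeight-≐ (only-[] , []-only) (HasWeight-singleton []))
      where
      S⊆∁T : ∀ {b} → b ∈ S → b ∉ T
      S⊆∁T b∈S b∈T = S∩T=∅ (_ , b∈S , b∈T)
      value : 1# ≈ μ (S ∩ ∁ T) p / μ S p
      value = sym (/-unique (μ-≉0 S) (trans (reflexive (≡.cong (λ T → μ T p)
        (Subset.⊆-antisym (Subset.p∩q⊆p S (∁ T)) (λ b∈S → ∈-∩∁⁺ b∈S (S⊆∁T b∈S))))) (sym (*-identityˡ _))))
      only-[] : (_≋ []) U.⊆ (𝓜 S U.∩ Max⊆ T)
      only-[] x≋[] = ([] , [] , x≋[]) , Max⊆-resp (≋-sym x≋[]) Max⊆-[]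
      []-only : (𝓜 S U.∩ Max⊆ T) U.⊆ (_≋ [])
      []-only {x} (x∈S , x⊆T) with reverseView x
      ... | []          = ≋-refl
      ... | y ∶ _ ∶ʳ b  with All.++⁻ʳ y (𝓜⇒All x∈S)
      ...   | b∈S ∷ [] = ⊥-elim (S⊆∁T b∈S (x⊆T (y , ≋-refl)))

  mass : Pred Trace 0ℓ → Carrier
  mass A = sup (FiniteSum A)

  -- Any set lies in the set of all traces, whose weight is finite by the case S = T = ⊤. From here
  -- on the weight is a function of the set.
  mass-HasWeight : ∀ A → HasWeight A (mass A)
  mass-HasWeight A = sup-hasWeight (HasWeight⇒Bounded
    (λ {x} _ → (All⇒𝓜 (All.universal (λ _ → Subset.∈⊤) x)) , λ {_} _ → Subset.∈⊤) (HasWeight-𝓜 ⊤ ⊤))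

  mass-≐ : ∀ {A B} → A ≐ B → mass A ≈ mass B
  mass-≐ A≐B = HasWeight-unique A≐B (mass-HasWeight _) (mass-HasWeight _)

  HasWeight⇒mass : ∀ {A s} → HasWeight A s → mass A ≈ s
  HasWeight⇒mass A≈s = sup-unique (mass-HasWeight _) A≈s

  mass-pos : ∀ {A} x → A x → 0# < mass A
  mass-pos {A} x x∈A = <-≤-trans (weight-pos x) (≤-trans (≤-reflexive (sym (+-identityʳ _)))
    (total-≤ (mass-HasWeight A) ([] ∷ []) (x∈A ∷ [])))

  ∩-rotate : ∀ {A B C : Pred Trace 0ℓ} → ((A U.∩ B) U.∩ C) ≐ (A U.∩ (C U.∩ B))
  ∩-rotate = (λ ((a , b) , c) → a , c , b) , λ (a , c , b) → (a , b) , c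

  B≈ : ∀ S A → B S p A ≈ μ S p * mass (A U.∩ 𝓜 S)
  B≈ S A = sup-unique (sup-isSup (0# , [] , [] , [] , refl) (_ , ub)) (ub , least)
    where
    m : Carrier
    m = mass (A U.∩ 𝓜 S)
    scaled : ∀ xs → sumList (map (λ x → μ S p * weight x) xs) ≈ μ S p * total xs
    scaled []       = sym (zeroʳ _)
    scaled (x ∷ xs) = trans (+-congˡ (scaled xs)) (sym (distribˡ _ _ _))
    Sums : Pred Carrier 0ℓ
    Sums s = ∃[ xs ] Unique xs × All (A U.∩ 𝓜 S) xs × s ≈ sumList (map (λ x → μ S p * weight x) xs)
    ub : IsUpperBound Sums (μ S p * m)
    ub {s} (xs , xs! , xs∈ , s≈) = begin
      s                   ≈⟨ trans s≈ (scaled xs) ⟩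
      μ S p * total xs    ≤⟨ *-monoˡ-≤ (<⇒≤ (μ-pos S)) (total-≤ (mass-HasWeight (A U.∩ 𝓜 S)) xs! xs∈) ⟩
      μ S p * m           ∎
    least : ∀ {b} → IsUpperBound Sums b → μ S p * m ≤ b
    least bound = *-sup-≤ (mass-HasWeight (A U.∩ 𝓜 S)) (<⇒≤ (μ-pos S)) (bound ([] , [] , [] , refl))
      λ (xs , xs! , xs∈ , x≈) → bound (xs , xs! , xs∈ , trans (*-congˡ x≈) (sym (scaled xs)))

  -- The factor `μ S p` occurs in the numerator and in the denominator of the conditional
  -- probability and cancels.
  D≈ : ∀ S T A → D S T p A ≈ mass (A U.∩ (𝓜 S U.∩ Max⊆ T)) / mass (𝓜 S U.∩ Max⊆ T)
  D≈ S T A = /-unique (λ B≈0 → *-≉0 (μ-≉0 S) m≉0 (trans (sym B-T) B≈0)) (begin-equality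
    B S p (A U.∩ Max⊆ T)                          ≈⟨ B≈ S (A U.∩ Max⊆ T) ⟩
    μ S p * mass ((A U.∩ Max⊆ T) U.∩ 𝓜 S)         ≈⟨ *-congˡ (mass-≐ (∩-rotate {A} {Max⊆ T} {𝓜 S})) ⟩
    μ S p * mA                                    ≈⟨ *-congˡ (/-* m≉0) ⟨
    μ S p * (mA / m * m)                          ≈⟨ solve 3 (λ μ q m → μ :* (q :* m) := q :* (μ :* m)) refl (μ S p) (mA / m) m ⟩
    mA / m * (μ S p * m)                          ≈⟨ *-congˡ B-T ⟨
    mA / m * B S p (Max⊆ T)                       ∎)
    where
    m mA : Carrier
    m  = mass (𝓜 S U.∩ Max⊆ T)
    mA = mass (A U.∩ (𝓜 S U.∩ Max⊆ T))
    m≉0 : m ≉ 0#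
    m≉0 = >⇒≉ (mass-pos {𝓜 S U.∩ Max⊆ T} [] (All⇒𝓜 [] , Max⊆-[]))
    B-T : B S p (Max⊆ T) ≈ μ S p * m
    B-T = trans (B≈ S (Max⊆ T)) (*-congˡ (mass-≐ (∩-comm (Max⊆ T) (𝓜 S))))

-- Weights of decompositions with prescribed factors.

module Products (ℝ : CompleteOrderedField) where
  open CompleteOrderedField ℝ hiding (zero)
  open Reals ℝ

  ∏ : ℕ → (ℕ → Carrier) → Carrier
  ∏ m f = productList (applyUpTo f m)

  ∏-cong : ∀ m {f g} → (∀ i → i ℕ.< m → f i ≈ g i) → ∏ m f ≈ ∏ m g
  ∏-cong zero    f≈g = refl
  ∏-cong (suc m) f≈g = *-cong (f≈g 0 (s≤s z≤n)) (∏-cong m λ i i<m → f≈g (suc i) (s≤s i<m))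

  ∏-≉0 : ∀ m {f} → (∀ i → f i ≉ 0#) → ∏ m f ≉ 0#
  ∏-≉0 zero    f≉0 = >⇒≉ 0<1
  ∏-≉0 (suc m) f≉0 = *-≉0 (f≉0 0) (∏-≉0 m (f≉0 ∘ suc))

  ∏-/ : ∀ m {f g} → (∀ i → g i ≉ 0#) → ∏ m (λ i → f i / g i) * ∏ m g ≈ ∏ m f
  ∏-/ zero g≉0 = *-identityˡ 1#
  ∏-/ (suc m) {f} {g} g≉0 = begin-equality
    f 0 / g 0 * ∏ m (λ i → f (suc i) / g (suc i)) * (g 0 * ∏ m (g ∘ suc))
      ≈⟨ solve 4 (λ a b c d → a :* b :* (c :* d) := a :* c :* (b :* d)) refl (f 0 / g 0) _ (g 0) _ ⟩
    f 0 / g 0 * g 0 * (∏ m (λ i → f (suc i) / g (suc i)) * ∏ m (g ∘ suc))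
      ≈⟨ *-cong (/-* (g≉0 0)) (∏-/ m (g≉0 ∘ suc)) ⟩
    f 0 * ∏ m (f ∘ suc) ∎

  -- If f and g differ at i only, their products are in the ratio of f i to g i; stated by
  -- cross-multiplication. It yields the law of a single factor from the joint law.
  ∏-replace : ∀ m {f g i} → i ℕ.< m → (∀ j → j ≢ i → f j ≈ g j) → ∏ m f * g i ≈ f i * ∏ m g
  ∏-replace (suc m) {f} {g} {zero} _ f≈g = begin-equality
    f 0 * ∏ m (f ∘ suc) * g 0    ≈⟨ *-congʳ (*-congˡ (∏-cong m λ j _ → f≈g (suc j) λ ())) ⟩
    f 0 * ∏ m (g ∘ suc) * g 0    ≈⟨ solve 3 (λ a b c → a :* b :* c := a :* (c :* b)) refl (f 0) _ (g 0) ⟩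
    f 0 * (g 0 * ∏ m (g ∘ suc))  ∎
  ∏-replace (suc m) {f} {g} {suc i} (s≤s i<m) f≈g = begin-equality
    f 0 * ∏ m (f ∘ suc) * g (suc i)    ≈⟨ *-assoc _ _ _ ⟩
    f 0 * (∏ m (f ∘ suc) * g (suc i))  ≈⟨ *-cong (f≈g 0 λ ()) (∏-replace m i<m λ j j≢i → f≈g (suc j) (j≢i ∘ ℕ.suc-injective)) ⟩
    g 0 * (f (suc i) * ∏ m (g ∘ suc))  ≈⟨ solve 3 (λ a b c → a :* (b :* c) := b :* (a :* c)) refl (g 0) _ _ ⟩
    f (suc i) * (g 0 * ∏ m (g ∘ suc))  ∎

module Decompositions (ℝ : CompleteOrderedField)
    {n : ℕ} (R : Rel (Fin n) 0ℓ) (R? : Decidable R) (R-refl : Reflexive R) (R-sym : Symmetric R)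
    (p : CompleteOrderedField.Carrier ℝ)
    (0<p : CompleteOrderedField._<_ ℝ (CompleteOrderedField.0# ℝ) p)
    (μ-pos : ∀ S → CompleteOrderedField._<_ ℝ (CompleteOrderedField.0# ℝ) (Traces.Laws.μ R R? ℝ S p))
    (a : Fin n) (T : Subset n) (a∈T : a ∈ T) where
  open CompleteOrderedField ℝ hiding (zero)
  open Reals ℝ
  open Products ℝ
  open Traces R R?
  open Laws ℝ
  open TraceTheory R R? R-refl R-sym
  open Weights ℝ R R? R-refl R-sym p 0<p
  open PyramidWeights ℝ R R? R-refl R-sym p 0<p μ-pos

  baseMass pyramidMass : Pred Trace 0ℓ → Carrier
  baseMass A    = mass (A U.∩ (𝓜 (∁ ⁅ a ⁆) U.∩ Max⊆ T))
  pyramidMass A = mass (Pyr a U.∩ A)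

  -- The weight of the choices for the i-th factor of a decomposition u 0 ⋯ u k;
  -- irrelevant for i > k.
  factorMass : (k i : ℕ) → Pred Trace 0ℓ → Carrier
  factorMass zero    _       = baseMass
  factorMass (suc k) zero    = pyramidMass
  factorMass (suc k) (suc i) = factorMass k i

  factorMass-< : ∀ {k i} → i ℕ.< k → ∀ A → factorMass k i A ≡ pyramidMass A
  factorMass-< {suc k} {zero}  _         A = ≡.refl
  factorMass-< {suc k} {suc i} (s≤s i<k) A = factorMass-< i<k A

  factorMass-≡ : ∀ k A → factorMass k k A ≡ baseMass A
  factorMass-≡ zero    A = ≡.refl
  factorMass-≡ (suc k) A = factorMass-≡ k A

  factorMass-cong : ∀ k i {A B} → A ≐ B → factorMass k i A ≈ factorMass k i B
  factorMass-cong zero    i       (A⊆B , B⊆A) = mass-≐ ((λ (x , y) → A⊆B x , y) , λ (x , y) → B⊆A x , y)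
  factorMass-cong (suc k) zero    (A⊆B , B⊆A) = mass-≐ ((λ (x , y) → x , A⊆B y) , λ (x , y) → x , B⊆A y)
  factorMass-cong (suc k) (suc i) A≐B         = factorMass-cong k i A≐B

  factorMass-U>0 : ∀ k i → 0# < factorMass k i U.U
  factorMass-U>0 zero    i       = mass-pos {U.U U.∩ (𝓜 (∁ ⁅ a ⁆) U.∩ Max⊆ T)} [] (_ , All⇒𝓜 [] , Max⊆-[])
  factorMass-U>0 (suc k) zero    = mass-pos {Pyr a U.∩ U.U} [ a ] (([] , All⇒𝓜 [] , Max⊆-[] , ≋-refl) , _)
  factorMass-U>0 (suc k) (suc i) = factorMass-U>0 k i

  -- A condition on the factors, phrased as a set of traces so that the law of the random trace can
  -- be applied to it.
  Decomposed : ℕ → (ℕ → Pred Trace 0ℓ) → Pred Trace 0ℓ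
  Decomposed k A x = ∃[ u ] IsDecomposition a x k u × (∀ i → i ℕ.≤ k → A i (u i))

  Decomposed-resp : ∀ {k A} → Decomposed k A Respects _≋_
  Decomposed-resp x≋y (u , dec , u∈A) = u , IsDecomposition-resp x≋y dec , u∈A

  Decomposed-zero : ∀ {A} → (∀ i → A i Respects _≋_) →
    (A 0 U.∩ (𝓜 (∁ ⁅ a ⁆) U.∩ Max⊆ T)) ≐ (Decomposed 0 A U.∩ Max⊆ T)
  Decomposed-zero {A} A-resp =
    (λ {x} (x∈A , x∈ , x⊆T) →
      ((λ _ → x) , ((λ _ ()) , x∈ , ≋-reflexive (≡.sym (List.++-identityʳ x))) , λ { zero z≤n → x∈A }) , x⊆T) ,
    λ ((u , (_ , u∈ , x≋u[]) , u∈A) , x⊆T) → let x≋u = ≋-trans x≋u[] (≋-reflexive (List.++-identityʳ (u 0))) in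
      A-resp 0 (≋-sym x≋u) (u∈A 0 z≤n) , 𝓜-resp (≋-sym x≋u) u∈ , x⊆T

  Decomposed-suc : ∀ {k A} →
    (Pyr a U.∩ A 0) · (Decomposed k (A ∘ suc) U.∩ Max⊆ T) ≐ (Decomposed (suc k) A U.∩ Max⊆ T)
  Decomposed-suc {k} {A} = ⇒ , ⇐
    where
    ⇒ : ((Pyr a U.∩ A 0) · (Decomposed k (A ∘ suc) U.∩ Max⊆ T)) U.⊆ (Decomposed (suc k) A U.∩ Max⊆ T)
    ⇒ (v , y , (pv , v∈A) , ((u , (pu , u∈ , y≋u) , u∈A) , y⊆T) , x≋vy) =
      (w , (pw , u∈ , ≋-trans x≋vy (≋-cong ≋-refl y≋u)) , w∈A) ,
      Max⊆-resp (≋-sym x≋vy) (Pyr-++-Max⊆ a∈T pv y⊆T)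
      where
      w : ℕ → Trace
      w zero    = v
      w (suc i) = u i
      pw : ∀ i → i ℕ.< suc k → Pyr a (w i)
      pw zero    _         = pv
      pw (suc i) (s≤s i<k) = pu i i<k
      w∈A : ∀ i → i ℕ.≤ suc k → A i (w i)
      w∈A zero    _         = v∈A
      w∈A (suc i) (s≤s i≤k) = u∈A i i≤k
    ⇐ : (Decomposed (suc k) A U.∩ Max⊆ T) U.⊆ ((Pyr a U.∩ A 0) · (Decomposed k (A ∘ suc) U.∩ Max⊆ T))
    ⇐ ((u , dec , u∈A) , x⊆T) with IsDecomposition-cons dec
    ... | pu , dec′ , x≋ = u 0 , _ , (pu , u∈A 0 z≤n) ,
          ((u ∘ suc , dec′ , λ i i≤k → u∈A (suc i) (s≤s i≤k)) , Max⊆-++ʳ⁻ (u 0) (Max⊆-resp x≋ x⊆T)) , x≋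

  -- The first pyramid is split off, and masses multiply because the product is unambiguous. The
  -- condition `Max⊆ T` is handed on to the last factor: the only maximal letter of a pyramid is a,
  -- which belongs to T.
  HasWeight-Decomposed : ∀ k {A} → (∀ i → A i Respects _≋_) →
    HasWeight (Decomposed k A U.∩ Max⊆ T) (∏ (suc k) λ i → factorMass k i (A i))
  HasWeight-Decomposed zero {A} A-resp = IsSup-resp-≈ (sym (*-identityʳ _))
    (HasWeight-≐ (Decomposed-zero {A} A-resp) (mass-HasWeight _))
  HasWeight-Decomposed (suc k) {A} A-resp = HasWeight-≐ (Decomposed-suc {k} {A}) (HasWeight-·
    (λ (pu , _) (pv , _) _ _ → Pyr-++-injectiveˡ pu pv)
    (mass-HasWeight _) (HasWeight-Decomposed k (A-resp ∘ suc)))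

  D-Decomposed : ∀ k {A} → (∀ i → A i Respects _≋_) →
    D ⊤ T p (Decomposed k A) ≈ (∏ (suc k) λ i → factorMass k i (A i)) / mass (𝓜 ⊤ U.∩ Max⊆ T)
  D-Decomposed k {A} A-resp = trans (D≈ ⊤ T (Decomposed k A)) (*-congʳ (trans
    (mass-≐ {Decomposed k A U.∩ (𝓜 ⊤ U.∩ Max⊆ T)} {Decomposed k A U.∩ Max⊆ T}
      ((λ (d , _ , x⊆T) → d , x⊆T) ,
       λ {x} (d , x⊆T) → d , All⇒𝓜 (All.universal (λ _ → Subset.∈⊤) x) , x⊆T))
    (HasWeight⇒mass (HasWeight-Decomposed k A-resp))))

  rate : Carrier
  rate = p * (μ (∁ (𝓛 a)) p / μ (∁ ⁅ a ⁆) p)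

  HasWeight-Pyr : HasWeight (Pyr a) rate
  HasWeight-Pyr = ≡.subst₂ (λ S r → HasWeight (PyrIn S a) r) (Subset.∩-identityˡ _) (pyramidRate-⊤ a)
    (HasWeight-PyrIn (HasWeight-𝓜 _ (𝓛 a)) Subset.∈⊤)

  rate<1 : rate < 1#
  rate<1 = ≡.subst (_< 1#) (pyramidRate-⊤ a) (pyramidRate<1 {⊤} {a} Subset.∈⊤)

  pyramidMass-U : pyramidMass U.U ≈ rate
  pyramidMass-U = HasWeight⇒mass (HasWeight-≐ ((λ x → x , _) , proj₁) HasWeight-Pyr)

  mass-total : mass (𝓜 ⊤ U.∩ Max⊆ T) ≈ baseMass U.U / (1# - rate)
  mass-total = HasWeight⇒mass (HasWeight-pyramids Subset.∈⊤ a∈T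
    (≡.subst (λ S → HasWeight (PyrIn S a) rate) S≡ HasWeight-Pyr) rate<1
    (≡.subst (λ S → HasWeight (𝓜 S U.∩ Max⊆ T) (baseMass U.U)) S≡
      (HasWeight-≐ (proj₂ , (_ ,_)) (mass-HasWeight (U.U U.∩ (𝓜 (∁ ⁅ a ⁆) U.∩ Max⊆ T))))))
    where
    S≡ : ∁ ⁅ a ⁆ ≡ ⊤ ∩ ∁ ⁅ a ⁆
    S≡ = ≡.sym (Subset.∩-identityˡ _)

  ∏-factorMass-U : ∀ k → (∏ (suc k) λ i → factorMass k i U.U) ≈ rate ^ k * baseMass U.U
  ∏-factorMass-U zero    = *-comm _ _
  ∏-factorMass-U (suc k) = trans (*-cong pyramidMass-U (∏-factorMass-U k)) (sym (*-assoc _ _ _))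

  -- The total mass is `baseMass U.U / (1# - rate)`, so the mass of the last factor cancels.
  geometric : ∀ k → (∏ (suc k) λ i → factorMass k i U.U) / mass (𝓜 ⊤ U.∩ Max⊆ T) ≈ (1# - rate) * rate ^ k
  geometric k = /-unique (>⇒≉ (mass-pos {𝓜 ⊤ U.∩ Max⊆ T} [] (All⇒𝓜 [] , Max⊆-[]))) (begin-equality
    (∏ (suc k) λ i → factorMass k i U.U)        ≈⟨ ∏-factorMass-U k ⟩
    rate ^ k * baseMass U.U                     ≈⟨ *-congˡ (/-* (>⇒≉ (<⇒0<- rate<1))) ⟨
    rate ^ k * (baseMass U.U / (1# - rate) * (1# - rate))
      ≈⟨ solve 3 (λ x y z → x :* (y :* z) := z :* x :* y) refl (rate ^ k) _ (1# - rate) ⟩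
    (1# - rate) * rate ^ k * (baseMass U.U / (1# - rate))  ≈⟨ *-congˡ mass-total ⟨
    (1# - rate) * rate ^ k * mass (𝓜 ⊤ U.∩ Max⊆ T)         ∎)

  -- It expresses a condition on the pyramid without its apex as a condition on the pyramid itself;
  -- by right cancellation the choice of w does not matter.
  followedBy : Pred Trace 0ℓ → Pred Trace 0ℓ
  followedBy A x = ∃[ w ] x ≋ w ∷ʳ a × A w

  followedBy-resp : ∀ {A} → followedBy A Respects _≋_
  followedBy-resp x≋y (w , x≋wa , w∈A) = w , ≋-trans (≋-sym x≋y) x≋wa , w∈A

  followedBy-≐ : ∀ {A} → A Respects _≋_ →
    (A U.∩ (𝓜 (∁ ⁅ a ⁆) U.∩ Max⊆ (𝓛 a))) · (_≋ [ a ]) ≐ (Pyr a U.∩ followedBy A)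
  followedBy-≐ A-resp =
    (λ (z , y , (z∈A , z∈ , z⊆𝓛) , y≋a , x≋zy) → let x≋za = ≋-trans x≋zy (≋-cong ≋-refl y≋a) in
      (z , z∈ , z⊆𝓛 , x≋za) , z , x≋za , z∈A) ,
    λ ((z , z∈ , z⊆𝓛 , x≋za) , w , x≋wa , w∈A) →
      z , [ a ] , (A-resp (≋-cancelʳ [ a ] (≋-trans (≋-sym x≋wa) x≋za)) w∈A , z∈ , z⊆𝓛) , ≋-refl , x≋za

  pyramidMass-followedBy : ∀ {A} → A Respects _≋_ →
    pyramidMass (followedBy A) ≈ mass (A U.∩ (𝓜 (∁ ⁅ a ⁆) U.∩ Max⊆ (𝓛 a))) * weight [ a ]
  pyramidMass-followedBy {A} A-resp = HasWeight⇒mass (HasWeight-≐ (followedBy-≐ A-resp)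
    (HasWeight-·[ a ] (mass-HasWeight (A U.∩ (𝓜 (∁ ⁅ a ⁆) U.∩ Max⊆ (𝓛 a))))))

  -- The apex contributes the same factor `weight [ a ]` to both masses.
  pyramidMass-ratio : ∀ {A} → A Respects _≋_ →
    pyramidMass (followedBy A) / pyramidMass U.U ≈ D (∁ ⁅ a ⁆) (𝓛 a) p A
  pyramidMass-ratio {A} A-resp = /-unique (>⇒≉ (factorMass-U>0 1 0)) (begin-equality
    pyramidMass (followedBy A)     ≈⟨ pyramidMass-followedBy A-resp ⟩
    mA * weight [ a ]              ≈⟨ *-congʳ (/-* m≉0) ⟨
    mA / m * m * weight [ a ]      ≈⟨ *-assoc _ _ _ ⟩
    mA / m * (m * weight [ a ])    ≈⟨ *-cong (D≈ (∁ ⁅ a ⁆) (𝓛 a) A) U-mass ⟨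
    D (∁ ⁅ a ⁆) (𝓛 a) p A * pyramidMass U.U ∎)
    where
    m mA : Carrier
    m  = mass (𝓜 (∁ ⁅ a ⁆) U.∩ Max⊆ (𝓛 a))
    mA = mass (A U.∩ (𝓜 (∁ ⁅ a ⁆) U.∩ Max⊆ (𝓛 a)))
    m≉0 : m ≉ 0#
    m≉0 = >⇒≉ (mass-pos {𝓜 (∁ ⁅ a ⁆) U.∩ Max⊆ (𝓛 a)} [] (All⇒𝓜 [] , Max⊆-[]))
    U-mass : pyramidMass U.U ≈ m * weight [ a ]
    U-mass = HasWeight⇒mass (HasWeight-≐ ((λ x → proj₁ PyrIn-≐ x , _) , λ (x , _) → proj₂ PyrIn-≐ x)
      (HasWeight-·[ a ] (mass-HasWeight (𝓜 (∁ ⁅ a ⁆) U.∩ Max⊆ (𝓛 a)))))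

  baseMass-ratio : ∀ A → baseMass A / baseMass U.U ≈ D (∁ ⁅ a ⁆) T p A
  baseMass-ratio A = trans (/-congʳ (mass-≐ {U.U U.∩ (𝓜 (∁ ⁅ a ⁆) U.∩ Max⊆ T)} (proj₂ , (_ ,_)))) (sym (D≈ (∁ ⁅ a ⁆) T A))
    where
    /-congʳ : mass (U.U U.∩ (𝓜 (∁ ⁅ a ⁆) U.∩ Max⊆ T)) ≈ mass (𝓜 (∁ ⁅ a ⁆) U.∩ Max⊆ T) →
              baseMass A / baseMass U.U ≈ baseMass A / mass (𝓜 (∁ ⁅ a ⁆) U.∩ Max⊆ T)
    /-congʳ eq = /-unique (>⇒≉ (factorMass-U>0 0 0)) (sym (trans (*-congˡ eq)
      (/-* (λ m≈0 → >⇒≉ (factorMass-U>0 0 0) (trans eq m≈0)))))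

  -- From weights to probabilities.

  module RandomTrace (𝓟 : ProbabilitySpace ℝ) (ξ : ProbabilitySpace.Ω 𝓟 → Trace)
    (ξ-random : IsRandomTrace 𝓟 ξ) (ξ-law : HasLaw 𝓟 (ProbabilitySpace.P 𝓟) ξ (D ⊤ T p))
    (K : ProbabilitySpace.Ω 𝓟 → ℕ) (V : ℕ → ProbabilitySpace.Ω 𝓟 → Trace)
    (decomposition : ∀ ω → IsDecomposition a (ξ ω) (K ω) (λ i → V i ω)) where
    open ProbabilitySpace 𝓟

    Factors : ℕ → (ℕ → Pred Trace 0ℓ) → Pred Ω 0ℓ
    Factors k A ω = (∀ i → i ℕ.≤ k → A i (V i ω)) × K ω ≡ k

    -- Uniqueness of decompositions turns an event about `K` and `V` into an event about `ξ` alone;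
    -- its measurability and its probability are then those provided by `ξ`.
    Decomposed-≐ : ∀ k {A} → (∀ i → A i Respects _≋_) → (ξ ⊢ Decomposed k A) ≐ Factors k A
    Decomposed-≐ k {A} A-resp = from , λ { {ω} (V∈A , ≡.refl) → (λ i → V i ω) , decomposition ω , V∈A }
      where
      from : (ξ ⊢ Decomposed k A) U.⊆ Factors k A
      from {ω} (u , dec , u∈A)
        with ≡.refl ← ≡.trans (IsDecomposition-count k dec) (≡.sym (IsDecomposition-count (K ω) (decomposition ω))) =
        (λ i i≤k → A-resp i (IsDecomposition-unique k dec (decomposition ω) i i≤k) (u∈A i i≤k)) , ≡.refl

    P-Factors : ∀ k {A E} → (∀ i → A i Respects _≋_) → Factors k A ≐ E →
                P E ≈ (∏ (suc k) λ i → factorMass k i (A i)) / mass (𝓜 ⊤ U.∩ Max⊆ T)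
    P-Factors k {A} {E} A-resp F≐E = begin-equality
      P E                       ≈⟨ P-cong (ξ-random (Decomposed-resp {k} {A})) (≐-trans (Decomposed-≐ k A-resp) F≐E) ⟨
      P (ξ ⊢ Decomposed k A)    ≈⟨ ξ-law (Decomposed-resp {k} {A}) ⟩
      D ⊤ T p (Decomposed k A)  ≈⟨ D-Decomposed k A-resp ⟩
      (∏ (suc k) λ i → factorMass k i (A i)) / mass (𝓜 ⊤ U.∩ Max⊆ T) ∎

    P-K : ∀ k → P (λ ω → K ω ≡ k) ≈ (∏ (suc k) λ i → factorMass k i U.U) / mass (𝓜 ⊤ U.∩ Max⊆ T)
    P-K k = P-Factors k {λ _ → U.U} (λ _ _ _ → _) (proj₂ , ((λ _ _ → _) ,_))

    module Conditional (k : ℕ) where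
      Pₖ : Pred Ω 0ℓ → Carrier
      Pₖ = P given (λ ω → K ω ≡ k)

      Pₖ-Factors : ∀ {A E} → (∀ i → A i Respects _≋_) → Factors k A ≐ (E U.∩ (λ ω → K ω ≡ k)) →
                   Pₖ E ≈ (∏ (suc k) λ i → factorMass k i (A i)) / (∏ (suc k) λ i → factorMass k i U.U)
      Pₖ-Factors {A} {E} A-resp F≐E = /-unique PK≉0 (begin-equality
        P (E U.∩ (λ ω → K ω ≡ k))   ≈⟨ P-Factors k A-resp F≐E ⟩
        ∏A / m                      ≈⟨ *-congʳ (/-* ∏U≉0) ⟨
        ∏A / ∏U * ∏U / m            ≈⟨ *-assoc _ _ _ ⟩
        ∏A / ∏U * (∏U / m)          ≈⟨ *-congˡ (P-K k) ⟨
        ∏A / ∏U * P (λ ω → K ω ≡ k) ∎)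
        where
        ∏A ∏U m : Carrier
        ∏A = ∏ (suc k) λ i → factorMass k i (A i)
        ∏U = ∏ (suc k) λ i → factorMass k i U.U
        m  = mass (𝓜 ⊤ U.∩ Max⊆ T)
        0<m : 0# < m
        0<m = mass-pos {𝓜 ⊤ U.∩ Max⊆ T} [] (All⇒𝓜 [] , Max⊆-[])
        ∏U≉0 : ∏U ≉ 0#
        ∏U≉0 = ∏-≉0 (suc k) (λ i → >⇒≉ (factorMass-U>0 k i))
        PK≉0 : P (λ ω → K ω ≡ k) ≉ 0#
        PK≉0 PK≈0 = *-≉0 ∏U≉0 (>⇒≉ (⁻¹-pos 0<m)) (trans (sym (P-K k)) PK≈0)

      -- The unconstrained factors cancel. `E` has to agree with the event about `V i` only where K
      -- = k, since the traces W of the theorem are tied to the pyramids only there.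
      Pₖ-factor : ∀ {i A E} → i ℕ.≤ k → A Respects _≋_ →
        ((λ ω → A (V i ω)) U.∩ (λ ω → K ω ≡ k)) ≐ (E U.∩ (λ ω → K ω ≡ k)) →
        Pₖ E ≈ factorMass k i A / factorMass k i U.U
      Pₖ-factor {i} {A} {E} i≤k A-resp (A⊆E , E⊆A) = trans
        (Pₖ-Factors {A′} (λ _ x≋y x∈ j≡i → A-resp x≋y (x∈ j≡i))
          ((λ (V∈ , K≡k) → A⊆E (V∈ i i≤k ≡.refl , K≡k)) ,
           λ e → let V∈A , K≡k = E⊆A e in (λ { _ _ ≡.refl → V∈A }) , K≡k))
        (/-unique (∏-≉0 (suc k) (λ i → >⇒≉ (factorMass-U>0 k i))) (begin-equality
          ∏A′                     ≈⟨ /-* gi≉0 ⟨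
          ∏A′ / gi * gi           ≈⟨ solve 3 (λ x y z → x :* y :* z := x :* z :* y) refl ∏A′ (gi ⁻¹) gi ⟩
          ∏A′ * gi / gi           ≈⟨ *-congʳ (∏-replace (suc k) (s≤s i≤k) λ j j≢i → factorMass-cong k j
                                        ((λ _ → _) , λ _ j≡i → ⊥-elim (j≢i j≡i))) ⟩
          factorMass k i (A′ i) * ∏U / gi ≈⟨ *-congʳ (*-congʳ (factorMass-cong k i
                                        ((λ x → x ≡.refl) , λ x _ → x))) ⟩
          factorMass k i A * ∏U / gi      ≈⟨ solve 3 (λ x y z → x :* y :* z := x :* z :* y) refl _ ∏U (gi ⁻¹) ⟩
          factorMass k i A / gi * ∏U      ∎))
        where
        A′ : ℕ → Pred Trace 0ℓ
        -- The condition is vacuous at all indices other than i; the implication expresses this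
        -- without a case distinction on j.
        A′ j x = j ≡ i → A x
        ∏A′ ∏U gi : Carrier
        ∏A′ = ∏ (suc k) λ j → factorMass k j (A′ j)
        ∏U  = ∏ (suc k) λ j → factorMass k j U.U
        gi  = factorMass k i U.U
        gi≉0 : gi ≉ 0#
        gi≉0 = >⇒≉ (factorMass-U>0 k i)

      -- The joint probability is a quotient of two products over the same indices, hence the
      -- product of the quotients, and each of these is the probability for a single factor.
      independent : Independent 𝓟 Pₖ k V
      independent A A-resp = begin-equality
        Pₖ (λ ω → ∀ i → i ℕ.≤ k → A i (V i ω))
          ≈⟨ Pₖ-Factors A-resp (id , id) ⟩
        (∏ (suc k) λ i → factorMass k i (A i)) / (∏ (suc k) λ i → factorMass k i U.U)
          ≈⟨ /-unique (∏-≉0 (suc k) U≉0) (sym (∏-/ (suc k) {λ i → factorMass k i (A i)} U≉0)) ⟩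
        (∏ (suc k) λ i → factorMass k i (A i) / factorMass k i U.U)
          ≈⟨ ∏-cong (suc k) (λ { i (s≤s i≤k) → Pₖ-factor i≤k (A-resp i) (id , id) }) ⟨
        productList (applyUpTo (λ i → Pₖ (V i ⊢ A i)) (suc k)) ∎
        where
        U≉0 : ∀ i → factorMass k i U.U ≉ 0#
        U≉0 i = >⇒≉ (factorMass-U>0 k i)

      pyramid-law : ∀ i → i ℕ.< k → (W : Ω → Trace) → (∀ ω → K ω ≡ k → V i ω ≋ W ω ∷ʳ a) →
                    HasLaw 𝓟 Pₖ W (D (∁ ⁅ a ⁆) (𝓛 a) p)
      pyramid-law i i<k W V≋Wa {A} A-resp = begin-equality
        Pₖ (W ⊢ A)
          ≈⟨ Pₖ-factor (ℕ.<⇒≤ i<k) followedBy-resp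
               ((λ {ω} ((w , V≋wa , w∈A) , K≡k) →
                  A-resp (≋-cancelʳ [ a ] (≋-trans (≋-sym V≋wa) (V≋Wa ω K≡k))) w∈A , K≡k) ,
                λ {ω} (W∈A , K≡k) → (W ω , V≋Wa ω K≡k , W∈A) , K≡k) ⟩
        factorMass k i (followedBy A) / factorMass k i U.U
          ≡⟨ ≡.cong₂ _/_ (factorMass-< i<k (followedBy A)) (factorMass-< i<k U.U) ⟩
        pyramidMass (followedBy A) / pyramidMass U.U
          ≈⟨ pyramidMass-ratio A-resp ⟩
        D (∁ ⁅ a ⁆) (𝓛 a) p A ∎

      base-law : HasLaw 𝓟 Pₖ (V k) (D (∁ ⁅ a ⁆) T p)
      base-law {A} A-resp = begin-equality
        Pₖ (V k ⊢ A)                                 ≈⟨ Pₖ-factor ℕ.≤-refl A-resp (id , id) ⟩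
        factorMass k k A / factorMass k k U.U        ≡⟨ ≡.cong₂ _/_ (factorMass-≡ k A) (factorMass-≡ k U.U) ⟩
        baseMass A / baseMass U.U                    ≈⟨ baseMass-ratio A ⟩
        D (∁ ⁅ a ⁆) T p A                            ∎

theorem1p7 : (ℝ : CompleteOrderedField) →
    let open CompleteOrderedField ℝ in
    {n : ℕ} (R : Rel (Fin n) 0ℓ) (R? : Decidable R) → Reflexive R → Symmetric R →
    let open Traces R R? in
    let open Laws ℝ in
    (p pΣ : Carrier) → IsSmallestRoot ⊤ pΣ → 0# < p → p < pΣ →
    (a₁ : Fin n) →
    let r = p * (μ (∁ (𝓛 a₁)) p / μ (∁ ⁅ a₁ ⁆) p) in
    0# < μ (∁ ⁅ a₁ ⁆) p ×
    r ≈ 1# - μ ⊤ p / μ (∁ ⁅ a₁ ⁆) p ×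
    ((T : Subset n) → a₁ ∈ T →
    (𝓟 : ProbabilitySpace ℝ) → let open ProbabilitySpace 𝓟 in
    (ξ : Ω → Trace) → IsRandomTrace 𝓟 ξ → HasLaw 𝓟 P ξ (D ⊤ T p) →
    (K : Ω → ℕ) (U : ℕ → Ω → Trace) →
    (∀ ω → IsDecomposition a₁ (ξ ω) (K ω) (λ i → U i ω)) →
    (∀ ω → K ω ≡ length (filter (Fin._≟ a₁) (ξ ω))) ×
    (∀ k → P (λ ω → K ω ≡ k) ≈ (1# - r) * r ^ k) ×
    (∀ k → let Pₖ = P given (λ ω → K ω ≡ k) in
    Independent 𝓟 Pₖ k U ×
    (∀ i → i ℕ.< k → (W : Ω → Trace) →
    (∀ ω → K ω ≡ k → U i ω ≋ W ω ++ a₁ ∷ []) →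
    HasLaw 𝓟 Pₖ W (D (∁ ⁅ a₁ ⁆) (𝓛 a₁) p)) ×
    HasLaw 𝓟 Pₖ (U k) (D (∁ ⁅ a₁ ⁆) T p)))
theorem1p7 ℝ R R? R-refl R-sym p pΣ root 0<p p<pΣ a₁ =
  μ-pos (∁ ⁅ a₁ ⁆) ,
  -- The identity is available for `⊤ ∩ ∁ ⁅ a₁ ⁆` and `⊤ ∩ ∁ (𝓛 a₁)`, which equal the sets of the
  -- statement only propositionally.
  ≡.subst₂ (λ r S → r ≈ 1# - μ ⊤ p / μ S p) (pyramidRate-⊤ a₁) (Subset.∩-identityˡ _)
    (pyramidRate≈ {⊤} {a₁} Subset.∈⊤) ,
  λ T a₁∈T 𝓟 ξ ξ-random ξ-law K V decomposition →
    let open Decompositions ℝ R R? R-refl R-sym p 0<p μ-pos a₁ T a₁∈T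
        open RandomTrace 𝓟 ξ ξ-random ξ-law K V decomposition
    in (λ ω → IsDecomposition-count (K ω) (decomposition ω)) ,
       (λ k → trans (P-K k) (geometric k)) ,
       λ k → Conditional.independent k , Conditional.pyramid-law k , Conditional.base-law k
  where
  open CompleteOrderedField ℝ
  open Traces R R?
  open Laws ℝ
  open TraceTheory R R? R-refl R-sym using (IsDecomposition-count)
  open Möbius ℝ R R? R-refl R-sym using (μ-pos-below-root)
  μ-pos : ∀ S → 0# < μ S p
  μ-pos = μ-pos-below-root root 0<p p<pΣ
  open PyramidWeights ℝ R R? R-refl R-sym p 0<p μ-pos
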